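{- Let $m$ be a positive integer and let $p$ be a prime with $p\equiv 1\pmod{2m}$. Suppose that $2$ is an $m$th power residue modulo $p$. Then for any integer $a\not\equiv 0\pmod p$, we have $$\prod_{k\in R_m(p)}\left(i-e^{2\pi i a k/p}\right)=\left(\frac{ -2}{p}\right)_{2m} i^{(p-1)/(2m)}$$ and $$\prod_{k\in R_m(p)}\left(i+e^{2\pi i a k/p}\right)=\left(\frac{2}{p}\right)_{2m} i^{(p-1)/(2m)},$$ where $i=\sqrt{ -1}$.
   Context: For a positive integer $m$ and a prime $p\equiv 1\pmod m$, an integer $b\not\equiv 0\pmod p$ is an $m$th power residue modulo $p$ if $x^m\equiv b\pmod p$ for some integer $x$, and $R_m(p)=\{k\in\{1,\ldots,p-1\}:\ k \text{ is an } m\text{th power residue modulo } p\}$. For a positive integer $n$ with $p\equiv1\pmod n$ and an integer $b\not\equiv0\pmod p$, the $n$th power residue symbol $\left(\frac{b}{p}\right)_n$ is the unique $n$th root of unity $\zeta$ such that $b^{(p-1)/n}\equiv\zeta\pmod p$ in the ring of all algebraic integers. -}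

module Defs where

open import Data.Nat as ℕ using (ℕ; zero; suc; _≤?_; _<?_)
open import Data.Nat.Divisibility as ℕD using ()
open import Data.Integer as ℤ using (ℤ; +_; -[1+_]; -_; ∣_∣)
open import Data.Integer.Divisibility as ℤD using ()
open import Data.List using (List; []; _∷_; map; reverse; dropWhile; filter; length; foldr; replicate; _++_; upTo; any)
open import Data.Product using (Σ; _×_; _,_; proj₁)
open import Data.Bool using (Bool; true; false)
open import Relation.Nullary using (Dec; yes; no; does)
open import Relation.Binary.PropositionalEquality using (_≡_)

-- Polynomials over ℤ as coefficient lists (lowest degree first).
-- Used to model the cyclotomic ring ℤ[ζ_N] = ℤ[x]/(Φ_N(x)), ζ_N = e^{2πi/N}.

Poly : Set
Poly = List ℤ

infixl 6 _⊕_ _⊖_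
infixl 7 _⊗_

_⊕_ : Poly → Poly → Poly
[] ⊕ g = g
(a ∷ f) ⊕ [] = a ∷ f
(a ∷ f) ⊕ (b ∷ g) = (a ℤ.+ b) ∷ (f ⊕ g)

negP : Poly → Poly
negP = map -_

_⊖_ : Poly → Poly → Poly
f ⊖ g = f ⊕ negP g

scale : ℤ → Poly → Poly
scale c = map (c ℤ.*_)

_⊗_ : Poly → Poly → Poly
[] ⊗ g = []
(a ∷ f) ⊗ g = scale a g ⊕ (+ 0 ∷ (f ⊗ g))

const : ℤ → Poly
const c = c ∷ []

oneP : Poly
oneP = const (+ 1)

shift : ℕ → Poly → Poly
shift n f = replicate n (+ 0) ++ f

X^ : ℕ → Poly
X^ n = shift n oneP

_^P_ : Poly → ℕ → Poly
f ^P zero = oneP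
f ^P suc n = f ⊗ (f ^P n)

prodP : List Poly → Poly
prodP = foldr _⊗_ oneP

normalize : Poly → Poly
normalize f = reverse (dropWhile (ℤ._≟ + 0) (reverse f))

-- leading coefficient (of a normalized polynomial)
lc : Poly → ℤ
lc f with reverse f
... | [] = + 0
... | c ∷ _ = c

divMonic : ℕ → Poly → Poly → Poly × Poly
divMonic zero f g = [] , normalize f
divMonic (suc fuel) f g with normalize f | normalize g
... | f' | g' with length f' <? length g'
...   | yes _ = [] , f'
...   | no _ =
  let t = shift (length f' ℕ.∸ length g') (const (lc f'))
      r = divMonic fuel (f' ⊖ t ⊗ g') g'
  in (t ⊕ proj₁ r) , Data.Product.proj₂ r

properDivs : ℕ → List ℕ
properDivs N = filter (λ d → d ℕD.∣? N) (filter (λ d → 1 ≤? d) (upTo N))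

-- cyclotomic polynomials via x^N - 1 = ∏_{d ∣ N} Φ_d (with fuel)
cyc : ℕ → ℕ → Poly
cyc zero N = []
cyc (suc fuel) N =
  proj₁ (divMonic (suc N) (X^ N ⊖ oneP) (prodP (map (cyc fuel) (properDivs N))))

Φ : ℕ → Poly
Φ N = cyc (suc N) N

-- Equality in ℤ[ζ_N] ⊂ ℂ: f(ζ_N) = g(ζ_N), i.e. Φ_N ∣ f - g.
_≈⟨_⟩_ : Poly → ℕ → Poly → Set
f ≈⟨ N ⟩ g = normalize (Data.Product.proj₂ (divMonic (length (f ⊖ g)) (f ⊖ g) (Φ N))) ≡ []

-- ζ_N^t for an integer exponent t  (ζ_N^{-1} = ζ_N^{N-1})
ζpow : ℕ → ℤ → Poly
ζpow N (+ n) = X^ n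
ζpow N -[1+ n ] = X^ ((N ℕ.∸ 1) ℕ.* suc n)

-- R_m(p) = {k ∈ {1,…,p-1} : k is an m-th power residue mod p}.
-- Since x ↦ x mod p, it suffices to search x ∈ {0,…,p-1}.
R : ℕ → ℕ → List ℕ
R m p = filter (λ k → Data.List.Relation.Unary.Any.any?
                        (λ x → p ℕD.∣? ∣ (+ x) ℤ.^ m ℤ.- + k ∣) (upTo p))
               (map suc (upTo (p ℕ.∸ 1)))
  where import Data.List.Relation.Unary.Any

IsPowerResidue : ℕ → ℕ → ℤ → Set
IsPowerResidue m p b = Σ ℤ λ x → (+ p) ℤD.∣ (x ℤ.^ m ℤ.- b)

-- ζ (an element of ℤ[ζ_N]) is the n-th power residue symbol (b/p)_n, where
-- e = (p-1)/n: ζ is an n-th root of unity and b^e ≡ ζ (mod p) in ℤ[ζ_N].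
IsPRS : (N p n e : ℕ) → ℤ → Poly → Set
IsPRS N p n e b ζ =
  ((ζ ^P n) ≈⟨ N ⟩ oneP) × Σ Poly (λ c → (const (b ℤ.^ e) ⊖ ζ) ≈⟨ N ⟩ scale (+ p) c)

{-# OPTIONS --safe #-}

-- Let H be the group of m-th power residues modulo p.  It has 2q elements and contains −1, so the
-- factors can be paired: (i ∓ ζ^h)(i ∓ ζ^(−h)) = ∓ i (ζ^h + ζ^(−h)).  As 2 ∈ H, multiplication by 2
-- permutes a half system of H up to signs, and ζ^h + ζ^(−h) = (ζ^(2h) − ζ^(−2h)) / (ζ^h − ζ^(−h)), so
-- the product of these sums over the half system is a sign ε.  The same argument with h in place of
-- ζ^h − ζ^(−h) gives 2^q ≡ ε (mod p), as in Gauss's lemma, whence the symbols of 2 and −2 are ε and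
-- (−1)^q ε: a (2m)-th root of unity congruent to ±1 modulo p equals ±1.
--
-- About ℤ[x]/(Φ_N) this needs only that Φ_N is monic and divides 1 + x^g + ⋯ + x^(N−g) for every
-- proper divisor g of N; this holds because distinct Φ_d, Φ_e with d, e < N are coprime over ℚ.

module Submission where

open import Defs hiding (_≈⟨_⟩_)
open import Algebra using (CommutativeMonoid; CommutativeRing)
open import Algebra.Solver.Ring.AlmostCommutativeRing using (_-Raw-AlmostCommutative⟶_; fromCommutativeRing)
open import Data.Integer as ℤ using (ℤ; +_; -[1+_]; ∣_∣)
open import Data.Integer.Divisibility as ℤD using ()
open import Data.Integer.DivMod using (_%ℕ_; _/ℕ_; n%ℕd<d; a≡a%ℕn+[a/ℕn]*n)
open import Data.List using (List; []; _∷_; map; length; foldr; filter; concatMap; replicate; reverse; dropWhile; upTo; _++_; _∷ʳ_)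
open import Data.List.Membership.Propositional using (_∈_; lose)
open import Data.List.Membership.Propositional.Properties
  using (∈-∃++; ∈-filter⁺; ∈-filter⁻; ∈-upTo⁺; ∈-upTo⁻; ∈-map⁺; ∈-map⁻; ∈-++⁺ˡ; ∈-++⁺ʳ; ∈-++⁻; ∈-concatMap⁺)
open import Data.List.Relation.Binary.Permutation.Propositional as ↭ using (_↭_; ↭-refl; ↭-sym; ↭-trans)
open import Data.List.Relation.Binary.Subset.Propositional using (_⊆_)
open import Data.List.Relation.Unary.All as All using ([]; _∷_)
open import Data.List.Relation.Unary.AllPairs using ([]; _∷_)
open import Data.List.Relation.Unary.Any as Any using (here; there)
open import Data.List.Relation.Unary.Unique.Propositional using (Unique)
open import Data.Maybe using (Maybe; just; nothing)
open import Data.Nat using (ℕ; zero; suc; _+_; _*_; _∸_; _≤_; _<_; z≤n; s≤s; _≤?_; _<?_)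
open import Data.Nat.Coprimality using (Coprime; coprime-Bézout)
open import Data.Nat.Divisibility as ℕD using (_∣_; divides)
open import Data.Nat.GCD using (gcd; gcd[m,n]∣m; gcd[m,n]≢0; gcd-comm; gcd-GCD; module Bézout)
open import Data.Nat.Induction using (<-rec)
open import Data.Nat.ListAction using (sum)
open import Data.Nat.Primality using (Prime; euclidsLemma; prime⇒irreducible; prime⇒nonTrivial; prime⇒nonZero)
open import Data.Product using (_×_; _,_; proj₁; proj₂; ∃-syntax)
open import Data.Sum using (inj₁; inj₂; [_,_]′)
open import Level using (0ℓ)
open import Relation.Binary using (Setoid)
open import Relation.Binary.PropositionalEquality using (_≡_; _≢_; refl; sym; trans; cong; cong₂; subst; ≢-sym; module ≡-Reasoning)
open import Relation.Nullary using (¬_; yes; no; contradiction)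
import Algebra.Properties.CommutativeSemigroup as CommutativeSemigroupProperties
import Algebra.Properties.CommutativeSemiring.Exp as CommutativeExp
import Algebra.Properties.Ring as RingProperties
import Algebra.Properties.Semiring.Exp as Exponentiation
import Algebra.Solver.Ring
import Algebra.Solver.Ring.NaturalCoefficients.Default as NaturalSolver
import Data.Integer.Divisibility.Signed as ℤS
import Data.Integer.Properties as ℤₚ
import Data.Integer.Solver
import Data.List.Properties as Listₚ
import Data.List.Relation.Binary.Permutation.Propositional.Properties as ↭ₚ
import Data.List.Relation.Unary.All.Properties as Allₚ
import Data.List.Relation.Unary.Unique.Propositional.Properties as Uniqueₚ
import Data.Nat as ℕ
import Data.Nat.Properties as ℕₚ
import Data.Nat.Solver
import Relation.Binary.Reasoning.Setoid

open import Data.List.Membership.DecPropositional ℕ._≟_ using (_∈?_)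
open Data.Nat.Solver.+-*-Solver using ()
  renaming (solve to solveℕ; con to conℕ; _:+_ to _+ℕ_; _:*_ to _*ℕ_; _:=_ to _=ℕ_)
open Data.Integer.Solver.+-*-Solver using ()
  renaming (solve to solveℤ; con to conℤ; _:+_ to _+ℤ_; _:-_ to _-ℤ_; _:*_ to _*ℤ_; :-_ to -ℤ_; _:=_ to _=ℤ_)

-- Two steps of the sketch are immediate in the complex numbers but not in ℤ[x]/(Φ_N), about which
-- no absence of zero divisors is established. The first is division by ζ^h - ζ^(-h). It becomes
-- cancellation: an element fixed by a suitable power of the p-th root of unity z is fixed by z,
-- hence is multiplied by p under 1 + z + ⋯ + z^(p-1) = 0, and a quotient of ℤ[x] by a monic
-- polynomial has no torsion. The second is that a (2m)-th root of unity y congruent to 1 modulo p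
-- equals 1. As 2m divides p - 1 it is invertible modulo p, which makes y - 1 a multiple of p (y -
-- 1). Iterating, y - 1 is divisible by every power of p, and its integer coordinates must vanish.

-- Permutations of lists without repetition

-- The complement `zs` is returned because it is needed later as data: in `X^-1∣properΦ` the product
-- over it is the cofactor.
unique-⊆⇒↭ : ∀ {A : Set} {xs ys : List A} → Unique ys → ys ⊆ xs → ∃[ zs ] xs ↭ ys ++ zs
unique-⊆⇒↭ {xs = xs} {[]}     []       ys⊆ = xs , ↭-refl
unique-⊆⇒↭ {xs = xs} {y ∷ ys} (y∉ ∷ u) ys⊆ with ∈-∃++ (ys⊆ (here refl))
... | as , bs , refl = zs , ↭-trans (↭ₚ.shift y as bs) (↭.prep y perm)
  where
  ys⊆′ : ys ⊆ as ++ bs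
  ys⊆′ {x} x∈ with ↭ₚ.∈-resp-↭ (↭ₚ.shift y as bs) (ys⊆ (there x∈))
  ... | here refl = contradiction refl (All.lookup y∉ x∈)
  ... | there x∈′ = x∈′
  rest = unique-⊆⇒↭ u ys⊆′
  zs   = proj₁ rest
  perm = proj₂ rest

unique-⊆⇒length≤ : ∀ {A : Set} {xs ys : List A} → Unique ys → ys ⊆ xs → length ys ≤ length xs
unique-⊆⇒length≤ {ys = ys} u ys⊆ with unique-⊆⇒↭ u ys⊆
... | zs , perm rewrite ↭ₚ.↭-length perm | Listₚ.length-++ ys {zs} = ℕₚ.m≤m+n (length ys) (length zs)

-- Applied with `ys` the image of `xs` under an injective self-map, this says that the map permutes
-- `xs`: multiplication on the units, `fold` on the half system.
unique-⊆-length⇒↭ : ∀ {A : Set} {xs ys : List A} → Unique ys → ys ⊆ xs → length xs ≤ length ys → xs ↭ ys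
unique-⊆-length⇒↭ {ys = ys} u ys⊆ len with unique-⊆⇒↭ u ys⊆
... | []     , perm = subst (_ ↭_) (Listₚ.++-identityʳ ys) perm
... | z ∷ zs , perm = contradiction len (ℕₚ.<⇒≱ (subst (length ys <_)
      (sym (trans (↭ₚ.↭-length perm) (Listₚ.length-++ ys))) (ℕₚ.m<m+n (length ys) (s≤s z≤n))))

unique-⊆⊇⇒↭ : ∀ {A : Set} {xs ys : List A} → Unique xs → Unique ys → ys ⊆ xs → xs ⊆ ys → xs ↭ ys
unique-⊆⊇⇒↭ u u′ ys⊆ xs⊆ = unique-⊆-length⇒↭ u′ ys⊆ (unique-⊆⇒length≤ u xs⊆)

unique-map : ∀ {A B : Set} {f : A → B} xs → (∀ {x y} → x ∈ xs → y ∈ xs → f x ≡ f y → x ≡ y) →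
             Unique xs → Unique (map f xs)
unique-map []       inj []       = []
unique-map (x ∷ xs) inj (x∉ ∷ u) =
  Allₚ.map⁺ (All.tabulate λ y∈ fx≡fy → All.lookup x∉ y∈ (inj (here refl) (there y∈) fx≡fy))
  ∷ unique-map xs (λ x∈ y∈ → inj (there x∈) (there y∈)) u

-- Finite products over lists in a commutative monoid

module Products (M : CommutativeMonoid 0ℓ 0ℓ) where
  open CommutativeMonoid M renaming (refl to ≈-refl; sym to ≈-sym; trans to ≈-trans)
  open CommutativeSemigroupProperties commutativeSemigroup using (interchange; x∙yz≈y∙xz)
  open import Algebra.Definitions.RawMonoid rawMonoid using () renaming (_×_ to _×ᴹ_)

  -- In the multiplicative monoids of ℤ[x] and its quotients this unfolds to `prodP (map f xs)`, so
  -- results about it apply to `prodP` directly.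
  ∏ : {A : Set} → (A → Carrier) → List A → Carrier
  ∏ f xs = foldr _∙_ ε (map f xs)

  module _ {A : Set} where
    ∏-cong : ∀ {f g : A → Carrier} xs → (∀ {x} → x ∈ xs → f x ≈ g x) → ∏ f xs ≈ ∏ g xs
    ∏-cong []       e = ≈-refl
    ∏-cong (x ∷ xs) e = ∙-cong (e (here refl)) (∏-cong xs (λ x∈ → e (there x∈)))

    ∏-↭ : ∀ (f : A → Carrier) {xs ys} → xs ↭ ys → ∏ f xs ≈ ∏ f ys
    ∏-↭ f ↭.refl         = ≈-refl
    ∏-↭ f (↭.prep x p)   = ∙-congˡ (∏-↭ f p)
    ∏-↭ f (↭.swap x y p) = ≈-trans (∙-congˡ (∙-congˡ (∏-↭ f p))) (x∙yz≈y∙xz (f x) (f y) _)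
    ∏-↭ f (↭.trans p p′) = ≈-trans (∏-↭ f p) (∏-↭ f p′)

    ∏-++ : ∀ (f : A → Carrier) xs ys → ∏ f (xs ++ ys) ≈ ∏ f xs ∙ ∏ f ys
    ∏-++ f []       ys = ≈-sym (identityˡ _)
    ∏-++ f (x ∷ xs) ys = ≈-trans (∙-congˡ (∏-++ f xs ys)) (≈-sym (assoc (f x) _ _))

    ∏-∙ : ∀ (f g : A → Carrier) xs → ∏ (λ x → f x ∙ g x) xs ≈ ∏ f xs ∙ ∏ g xs
    ∏-∙ f g []       = ≈-sym (identityˡ ε)
    ∏-∙ f g (x ∷ xs) = ≈-trans (∙-congˡ (∏-∙ f g xs)) (interchange (f x) (g x) _ _)

    ∏-const : ∀ c (xs : List A) → ∏ (λ _ → c) xs ≡ length xs ×ᴹ c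
    ∏-const c []       = refl
    ∏-const c (x ∷ xs) = cong (c ∙_) (∏-const c xs)

    ∏-map : ∀ {B : Set} (f : A → Carrier) (g : B → A) xs → ∏ f (map g xs) ≡ ∏ (λ x → f (g x)) xs
    ∏-map f g xs = cong (foldr _∙_ ε) (sym (Listₚ.map-∘ xs))

-- The commutative ring ℤ[x]

coeff : Poly → ℕ → ℤ
coeff []      n       = + 0
coeff (a ∷ f) zero    = a
coeff (a ∷ f) (suc n) = coeff f n

infix 4 _≋_

-- Lists differing by trailing zeros are the same polynomial, so equality compares coefficients. The
-- record wrapper lets `f` and `g` be recovered by unification.
record _≋_ (f g : Poly) : Set where
  constructor mk≋
  field at : ∀ n → coeff f n ≡ coeff g n

open _≋_ public

≋-refl : ∀ {f} → f ≋ f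
≋-refl .at _ = refl

≋-sym : ∀ {f g} → f ≋ g → g ≋ f
≋-sym e .at n = sym (at e n)

≋-trans : ∀ {f g h} → f ≋ g → g ≋ h → f ≋ h
≋-trans e e′ .at n = trans (at e n) (at e′ n)

∷-cong : ∀ {a b f g} → a ≡ b → f ≋ g → a ∷ f ≋ b ∷ g
∷-cong a≡b e .at zero    = a≡b
∷-cong a≡b e .at (suc n) = at e n

0∷[]≋[] : + 0 ∷ [] ≋ []
0∷[]≋[] .at zero    = refl
0∷[]≋[] .at (suc n) = refl

coeff-⊕ : ∀ f g n → coeff (f ⊕ g) n ≡ coeff f n ℤ.+ coeff g n
coeff-⊕ []      g       n       = sym (ℤₚ.+-identityˡ _)
coeff-⊕ (a ∷ f) []      n       = sym (ℤₚ.+-identityʳ _)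
coeff-⊕ (a ∷ f) (b ∷ g) zero    = refl
coeff-⊕ (a ∷ f) (b ∷ g) (suc n) = coeff-⊕ f g n

coeff-negP : ∀ f n → coeff (negP f) n ≡ ℤ.- coeff f n
coeff-negP []      n       = refl
coeff-negP (a ∷ f) zero    = refl
coeff-negP (a ∷ f) (suc n) = coeff-negP f n

coeff-scale : ∀ c f n → coeff (scale c f) n ≡ c ℤ.* coeff f n
coeff-scale c []      n       = sym (ℤₚ.*-zeroʳ c)
coeff-scale c (a ∷ f) zero    = refl
coeff-scale c (a ∷ f) (suc n) = coeff-scale c f n

⊕-cong : ∀ {f f′ g g′} → f ≋ f′ → g ≋ g′ → f ⊕ g ≋ f′ ⊕ g′
⊕-cong {f} {f′} {g} {g′} e e′ .at n
  rewrite coeff-⊕ f g n | coeff-⊕ f′ g′ n | at e n | at e′ n = refl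

⊕-assoc : ∀ f g h → (f ⊕ g) ⊕ h ≋ f ⊕ (g ⊕ h)
⊕-assoc f g h .at n
  rewrite coeff-⊕ (f ⊕ g) h n | coeff-⊕ f g n | coeff-⊕ f (g ⊕ h) n | coeff-⊕ g h n
  = ℤₚ.+-assoc (coeff f n) (coeff g n) (coeff h n)

⊕-comm : ∀ f g → f ⊕ g ≋ g ⊕ f
⊕-comm f g .at n
  rewrite coeff-⊕ f g n | coeff-⊕ g f n = ℤₚ.+-comm (coeff f n) (coeff g n)

⊕-identityʳ : ∀ f → f ⊕ [] ≋ f
⊕-identityʳ f .at n rewrite coeff-⊕ f [] n = ℤₚ.+-identityʳ (coeff f n)

negP-cong : ∀ {f g} → f ≋ g → negP f ≋ negP g
negP-cong {f} {g} e .at n rewrite coeff-negP f n | coeff-negP g n = cong ℤ.-_ (at e n)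

⊕-inverseʳ : ∀ f → f ⊕ negP f ≋ []
⊕-inverseʳ f .at n
  rewrite coeff-⊕ f (negP f) n | coeff-negP f n = ℤₚ.+-inverseʳ (coeff f n)

scale-cong : ∀ c {f g} → f ≋ g → scale c f ≋ scale c g
scale-cong c {f} {g} e .at n
  rewrite coeff-scale c f n | coeff-scale c g n = cong (c ℤ.*_) (at e n)

scale-⊕ : ∀ c f g → scale c (f ⊕ g) ≋ scale c f ⊕ scale c g
scale-⊕ c f g .at n
  rewrite coeff-scale c (f ⊕ g) n | coeff-⊕ f g n | coeff-⊕ (scale c f) (scale c g) n
        | coeff-scale c f n | coeff-scale c g n
  = ℤₚ.*-distribˡ-+ c (coeff f n) (coeff g n)

scale-* : ∀ c d f → scale (c ℤ.* d) f ≋ scale c (scale d f)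
scale-* c d f .at n
  rewrite coeff-scale (c ℤ.* d) f n | coeff-scale c (scale d f) n | coeff-scale d f n
  = ℤₚ.*-assoc c d (coeff f n)

scale-1 : ∀ f → scale (+ 1) f ≋ f
scale-1 f .at n rewrite coeff-scale (+ 1) f n = ℤₚ.*-identityˡ (coeff f n)

scale-0 : ∀ f → scale (+ 0) f ≋ []
scale-0 f .at n rewrite coeff-scale (+ 0) f n = ℤₚ.*-zeroˡ (coeff f n)

⊕-congˡ : ∀ f {g g′} → g ≋ g′ → f ⊕ g ≋ f ⊕ g′
⊕-congˡ f = ⊕-cong (≋-refl {f})

⊕-congʳ : ∀ g {f f′} → f ≋ f′ → f ⊕ g ≋ f′ ⊕ g
⊕-congʳ g e = ⊕-cong e (≋-refl {g})

≋-setoid : Setoid 0ℓ 0ℓ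
≋-setoid = record
  { Carrier       = Poly
  ; _≈_           = _≋_
  ; isEquivalence = record { refl = ≋-refl ; sym = ≋-sym ; trans = ≋-trans }
  }

module ≋-Reasoning = Relation.Binary.Reasoning.Setoid ≋-setoid

⊕-medial : ∀ f g h k → (f ⊕ g) ⊕ (h ⊕ k) ≋ (f ⊕ h) ⊕ (g ⊕ k)
⊕-medial = CommutativeSemigroupProperties.interchange (record
  { Carrier = Poly ; _≈_ = _≋_ ; _∙_ = _⊕_
  ; isCommutativeSemigroup = record
    { isSemigroup = record
      { isMagma = record { isEquivalence = Setoid.isEquivalence ≋-setoid ; ∙-cong = ⊕-cong }
      ; assoc   = ⊕-assoc }
    ; comm = ⊕-comm } })

⊗-congˡ : ∀ f {g g′} → g ≋ g′ → f ⊗ g ≋ f ⊗ g′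
⊗-congˡ []      e = ≋-refl
⊗-congˡ (a ∷ f) e = ⊕-cong (scale-cong a e) (∷-cong refl (⊗-congˡ f e))

⊗-zeroʳ : ∀ f → f ⊗ [] ≋ []
⊗-zeroʳ []      = ≋-refl
⊗-zeroʳ (a ∷ f) = ≋-trans (∷-cong refl (⊗-zeroʳ f)) 0∷[]≋[]

-- Multiplication recurses on its left factor; this is the mirrored recursion, from which
-- commutativity follows by induction.
⊗-∷ʳ : ∀ f b g → f ⊗ (b ∷ g) ≋ scale b f ⊕ (+ 0 ∷ f ⊗ g)
⊗-∷ʳ []      b g = ≋-sym 0∷[]≋[]
⊗-∷ʳ (a ∷ f) b g = ∷-cong (cong (ℤ._+ + 0) (ℤₚ.*-comm a b)) (begin
  scale a g ⊕ f ⊗ (b ∷ g)                  ≈⟨ ⊕-cong ≋-refl (⊗-∷ʳ f b g) ⟩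
  scale a g ⊕ (scale b f ⊕ (+ 0 ∷ f ⊗ g))  ≈⟨ ⊕-assoc (scale a g) (scale b f) _ ⟨
  (scale a g ⊕ scale b f) ⊕ (+ 0 ∷ f ⊗ g)  ≈⟨ ⊕-cong (⊕-comm (scale a g) (scale b f)) ≋-refl ⟩
  (scale b f ⊕ scale a g) ⊕ (+ 0 ∷ f ⊗ g)  ≈⟨ ⊕-assoc (scale b f) (scale a g) _ ⟩
  scale b f ⊕ (scale a g ⊕ (+ 0 ∷ f ⊗ g))  ∎)
  where open ≋-Reasoning

⊗-comm : ∀ f g → f ⊗ g ≋ g ⊗ f
⊗-comm []      g = ≋-sym (⊗-zeroʳ g)
⊗-comm (a ∷ f) g = ≋-trans
  (⊕-cong ≋-refl (∷-cong refl (⊗-comm f g)))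
  (≋-sym (⊗-∷ʳ g a f))

-- Equal polynomials may be lists of different lengths, which obstructs induction on the left
-- factor. Congruence there is carried over from the right factor by commutativity.
⊗-cong : ∀ {f f′ g g′} → f ≋ f′ → g ≋ g′ → f ⊗ g ≋ f′ ⊗ g′
⊗-cong {f} {f′} {g} {g′} e e′ = begin
  f ⊗ g    ≈⟨ ⊗-congˡ f e′ ⟩
  f ⊗ g′   ≈⟨ ⊗-comm f g′ ⟩
  g′ ⊗ f   ≈⟨ ⊗-congˡ g′ e ⟩
  g′ ⊗ f′  ≈⟨ ⊗-comm g′ f′ ⟩
  f′ ⊗ g′  ∎
  where open ≋-Reasoning

⊗-congʳ : ∀ g {f f′} → f ≋ f′ → f ⊗ g ≋ f′ ⊗ g
⊗-congʳ g e = ⊗-cong e (≋-refl {g})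

⊗-distribˡ : ∀ f g h → f ⊗ (g ⊕ h) ≋ f ⊗ g ⊕ f ⊗ h
⊗-distribˡ []      g h = ≋-refl
⊗-distribˡ (a ∷ f) g h = begin
  scale a (g ⊕ h) ⊕ (+ 0 ∷ f ⊗ (g ⊕ h))
    ≈⟨ ⊕-cong (scale-⊕ a g h) (∷-cong refl (⊗-distribˡ f g h)) ⟩
  (scale a g ⊕ scale a h) ⊕ ((+ 0 ∷ f ⊗ g) ⊕ (+ 0 ∷ f ⊗ h))
    ≈⟨ ⊕-medial (scale a g) (scale a h) (+ 0 ∷ f ⊗ g) (+ 0 ∷ f ⊗ h) ⟩
  (scale a g ⊕ (+ 0 ∷ f ⊗ g)) ⊕ (scale a h ⊕ (+ 0 ∷ f ⊗ h))  ∎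
  where open ≋-Reasoning

⊗-distribʳ : ∀ f g h → (g ⊕ h) ⊗ f ≋ g ⊗ f ⊕ h ⊗ f
⊗-distribʳ f g h = begin
  (g ⊕ h) ⊗ f    ≈⟨ ⊗-comm (g ⊕ h) f ⟩
  f ⊗ (g ⊕ h)    ≈⟨ ⊗-distribˡ f g h ⟩
  f ⊗ g ⊕ f ⊗ h  ≈⟨ ⊕-cong (⊗-comm f g) (⊗-comm f h) ⟩
  g ⊗ f ⊕ h ⊗ f  ∎
  where open ≋-Reasoning

scale-⊗ : ∀ c f g → scale c f ⊗ g ≋ scale c (f ⊗ g)
scale-⊗ c []      g = ≋-refl
scale-⊗ c (a ∷ f) g = begin
  scale (c ℤ.* a) g ⊕ (+ 0 ∷ scale c f ⊗ g)
    ≈⟨ ⊕-cong (scale-* c a g) (∷-cong (sym (ℤₚ.*-zeroʳ c)) (scale-⊗ c f g)) ⟩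
  scale c (scale a g) ⊕ scale c (+ 0 ∷ f ⊗ g)
    ≈⟨ scale-⊕ c (scale a g) (+ 0 ∷ f ⊗ g) ⟨
  scale c (scale a g ⊕ (+ 0 ∷ f ⊗ g))  ∎
  where open ≋-Reasoning

0∷-⊗ : ∀ f g → (+ 0 ∷ f) ⊗ g ≋ + 0 ∷ f ⊗ g
0∷-⊗ f g = ⊕-cong (scale-0 g) ≋-refl

⊗-assoc : ∀ f g h → (f ⊗ g) ⊗ h ≋ f ⊗ (g ⊗ h)
⊗-assoc []      g h = ≋-refl
⊗-assoc (a ∷ f) g h = begin
  (scale a g ⊕ (+ 0 ∷ f ⊗ g)) ⊗ h
    ≈⟨ ⊗-distribʳ h (scale a g) (+ 0 ∷ f ⊗ g) ⟩
  scale a g ⊗ h ⊕ (+ 0 ∷ f ⊗ g) ⊗ h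
    ≈⟨ ⊕-cong (scale-⊗ a g h) (0∷-⊗ (f ⊗ g) h) ⟩
  scale a (g ⊗ h) ⊕ (+ 0 ∷ (f ⊗ g) ⊗ h)
    ≈⟨ ⊕-cong ≋-refl (∷-cong refl (⊗-assoc f g h)) ⟩
  scale a (g ⊗ h) ⊕ (+ 0 ∷ f ⊗ (g ⊗ h))  ∎
  where open ≋-Reasoning

const-⊗ : ∀ c f → const c ⊗ f ≋ scale c f
const-⊗ c f = ≋-trans (⊕-cong ≋-refl 0∷[]≋[]) (⊕-identityʳ (scale c f))

⊗-identityˡ : ∀ f → oneP ⊗ f ≋ f
⊗-identityˡ f = ≋-trans (const-⊗ (+ 1) f) (scale-1 f)

polyRing : CommutativeRing 0ℓ 0ℓ
polyRing = record
  { Carrier = Poly ; _≈_ = _≋_ ; _+_ = _⊕_ ; _*_ = _⊗_ ; -_ = negP ; 0# = [] ; 1# = oneP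
  ; isCommutativeRing = record
    { isRing = record
      { +-isAbelianGroup = record
        { isGroup = record
          { isMonoid = record
            { isSemigroup = record
              { isMagma = record { isEquivalence = Setoid.isEquivalence ≋-setoid ; ∙-cong = ⊕-cong }
              ; assoc = ⊕-assoc }
            ; identity = (λ f → ≋-refl) , ⊕-identityʳ }
          ; inverse = (λ f → ≋-trans (⊕-comm (negP f) f) (⊕-inverseʳ f)) , ⊕-inverseʳ
          ; ⁻¹-cong = negP-cong }
        ; comm = ⊕-comm }
      ; *-cong = ⊗-cong
      ; *-assoc = ⊗-assoc
      ; *-identity = ⊗-identityˡ , λ f → ≋-trans (⊗-comm f oneP) (⊗-identityˡ f)
      ; distrib = ⊗-distribˡ , ⊗-distribʳ }
    ; *-comm = ⊗-comm } }

const-* : ∀ c d → const (c ℤ.* d) ≋ const c ⊗ const d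
const-* c d = ≋-sym (const-⊗ c (const d))

const-≟ : ∀ c d → Maybe (const c ≋ const d)
const-≟ c d with c ℤ.≟ d
... | yes refl = just ≋-refl
... | no _     = nothing

constMorphism : ℤ.+-*-rawRing -Raw-AlmostCommutative⟶ fromCommutativeRing polyRing
constMorphism = record
  { ⟦_⟧ = const ; +-homo = λ _ _ → ≋-refl ; *-homo = const-* ; -‿homo = λ _ → ≋-refl
  ; 0-homo = 0∷[]≋[] ; 1-homo = ≋-refl }

module PolySolver = Algebra.Solver.Ring ℤ.+-*-rawRing (fromCommutativeRing polyRing) constMorphism const-≟

-- Degrees and division by monic polynomials

open PolySolver using (solve; con; _:+_; _:-_; _:*_; :-_; _:=_)

coeff-++-< : ∀ f g {n} → n < length f → coeff (f ++ g) n ≡ coeff f n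
coeff-++-< (a ∷ f) g {zero}  _       = refl
coeff-++-< (a ∷ f) g {suc n} (s≤s l) = coeff-++-< f g l

coeff-++-+ : ∀ f g k → coeff (f ++ g) (length f + k) ≡ coeff g k
coeff-++-+ []      g k = refl
coeff-++-+ (a ∷ f) g k = coeff-++-+ f g k

DegLt : Poly → ℕ → Set
DegLt f n = ∀ k → n ≤ k → coeff f k ≡ + 0

degLt-cong : ∀ {f g n} → f ≋ g → DegLt f n → DegLt g n
degLt-cong e b k n≤k = trans (sym (at e k)) (b k n≤k)

degLt-weaken : ∀ {f m n} → m ≤ n → DegLt f m → DegLt f n
degLt-weaken m≤n b k n≤k = b k (ℕₚ.≤-trans m≤n n≤k)

degLt-0 : ∀ {f} → DegLt f 0 → f ≋ []
degLt-0 b .at n = b n z≤n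

degLt-length : ∀ f → DegLt f (length f)
degLt-length []      k       _       = refl
degLt-length (a ∷ f) (suc k) (s≤s l) = degLt-length f k l

degLt-⊕ : ∀ {f g n} → DegLt f n → DegLt g n → DegLt (f ⊕ g) n
degLt-⊕ {f} {g} b b′ k n≤k rewrite coeff-⊕ f g k | b k n≤k | b′ k n≤k = refl

degLt-negP : ∀ {f n} → DegLt f n → DegLt (negP f) n
degLt-negP {f} b k n≤k rewrite coeff-negP f k | b k n≤k = refl

degLt-scale : ∀ c {f n} → DegLt f n → DegLt (scale c f) n
degLt-scale c {f} b k n≤k rewrite coeff-scale c f k | b k n≤k = ℤₚ.*-zeroʳ c

degLt-pred : ∀ {f n} → DegLt f (suc n) → coeff f n ≡ + 0 → DegLt f n
degLt-pred {f} {n} b c k n≤k with n ℕₚ.≟ k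
... | yes refl = c
... | no n≢k   = b k (ℕₚ.≤∧≢⇒< n≤k n≢k)

-- The bounds need not be sharp: either coefficient may be zero. `degLt-⊗` and `degLt-cofactor` rely
-- on this freedom.
coeff-⊗-top : ∀ h g {n d} → DegLt h (suc n) → DegLt g (suc d) →
              coeff (h ⊗ g) (n + d) ≡ coeff h n ℤ.* coeff g d
coeff-⊗-top []      g             b b′ = refl
coeff-⊗-top (a ∷ h) g {zero}  {d} b b′ = begin
  coeff (scale a g ⊕ (+ 0 ∷ h ⊗ g)) d
    ≡⟨ coeff-⊕ (scale a g) (+ 0 ∷ h ⊗ g) d ⟩
  coeff (scale a g) d ℤ.+ coeff (+ 0 ∷ h ⊗ g) d
    ≡⟨ cong₂ ℤ._+_ (coeff-scale a g d) (at vanish d) ⟩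
  a ℤ.* coeff g d ℤ.+ + 0
    ≡⟨ ℤₚ.+-identityʳ _ ⟩
  a ℤ.* coeff g d ∎
  where
  open ≡-Reasoning
  vanish : + 0 ∷ h ⊗ g ≋ []
  vanish = ≋-trans (∷-cong refl (⊗-congʳ g (degLt-0 {h} (λ k _ → b (suc k) (s≤s z≤n))))) 0∷[]≋[]
coeff-⊗-top (a ∷ h) g {suc n} {d} b b′ = begin
  coeff (scale a g ⊕ (+ 0 ∷ h ⊗ g)) (suc n + d)
    ≡⟨ coeff-⊕ (scale a g) (+ 0 ∷ h ⊗ g) (suc n + d) ⟩
  coeff (scale a g) (suc n + d) ℤ.+ coeff (h ⊗ g) (n + d)
    ≡⟨ cong₂ ℤ._+_ (degLt-scale a {g} b′ (suc n + d) (s≤s (ℕₚ.m≤n+m d n)))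
                   (coeff-⊗-top h g (λ k n<k → b (suc k) (s≤s n<k)) b′) ⟩
  + 0 ℤ.+ coeff h n ℤ.* coeff g d
    ≡⟨ ℤₚ.+-identityˡ _ ⟩
  coeff h n ℤ.* coeff g d ∎
  where open ≡-Reasoning

degLt-⊗ : ∀ h g {n d} → DegLt h (suc n) → DegLt g (suc d) → DegLt (h ⊗ g) (suc (n + d))
degLt-⊗ h g {n} {d} b b′ k n+d<k with ℕₚ.m≤n⇒∃[o]m+o≡n n+d<k
... | o , refl = begin
  coeff (h ⊗ g) (suc (n + d) + o)
    ≡⟨ cong (coeff (h ⊗ g)) (trans (cong (_+ o) (sym (ℕₚ.+-suc n d))) (ℕₚ.+-assoc n (suc d) o)) ⟩
  coeff (h ⊗ g) (n + (suc d + o))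
    ≡⟨ coeff-⊗-top h g b (degLt-weaken {g} (ℕₚ.≤-trans (ℕₚ.m≤m+n (suc d) o) (ℕₚ.n≤1+n _)) b′) ⟩
  coeff h n ℤ.* coeff g (suc d + o)
    ≡⟨ cong (coeff h n ℤ.*_) (b′ (suc d + o) (ℕₚ.m≤m+n (suc d) o)) ⟩
  coeff h n ℤ.* + 0
    ≡⟨ ℤₚ.*-zeroʳ (coeff h n) ⟩
  + 0 ∎
  where open ≡-Reasoning

record Monic (f : Poly) (d : ℕ) : Set where
  constructor monic
  field
    lead  : coeff f d ≡ + 1
    bound : DegLt f (suc d)

open Monic public

monic-cong : ∀ {f g d} → f ≋ g → Monic f d → Monic g d
monic-cong e (monic l b) = monic (trans (sym (at e _)) l) (degLt-cong e b)

monic-⊗ : ∀ {f g c d} → Monic f c → Monic g d → Monic (f ⊗ g) (c + d)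
monic-⊗ {f} {g} (monic l b) (monic l′ b′) =
  monic (trans (coeff-⊗-top f g b b′) (cong₂ ℤ._*_ l l′)) (degLt-⊗ f g b b′)

monic-oneP : Monic oneP 0
monic-oneP = monic refl λ { (suc k) _ → refl }

-- A monic factor preserves top coefficients, so the coefficient of `h` at any current bound `n ≥ k`
-- reappears in `h ⊗ g` at `n + d`, where it is zero. The bound on `h` therefore descends from the
-- list length to `k`.
degLt-cofactor : ∀ h {g d} k → Monic g d → DegLt (h ⊗ g) (k + d) → DegLt h k
degLt-cofactor h {g} {d} k M b = descend (length h) (degLt-length h)
  where
  descend : ∀ n → DegLt h n → DegLt h k
  descend n b′ with n ≤? k
  descend n       b′ | yes n≤k = degLt-weaken {h} n≤k b′
  descend zero    b′ | no 0≰k  = contradiction z≤n 0≰k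
  descend (suc n) b′ | no n≮k  = descend n (degLt-pred {h} b′ (begin
    coeff h n                ≡⟨ ℤₚ.*-identityʳ _ ⟨
    coeff h n ℤ.* + 1        ≡⟨ cong (coeff h n ℤ.*_) (lead M) ⟨
    coeff h n ℤ.* coeff g d  ≡⟨ coeff-⊗-top h g b′ (bound M) ⟨
    coeff (h ⊗ g) (n + d)    ≡⟨ b (n + d) (ℕₚ.+-monoˡ-≤ d (ℕₚ.≮⇒≥ n≮k)) ⟩
    + 0 ∎))
    where open ≡-Reasoning

short-multiple⇒0 : ∀ {f g d} h → Monic g d → DegLt f d → f ≋ h ⊗ g → h ≋ []
short-multiple⇒0 h M b e = degLt-0 (degLt-cofactor h 0 M (degLt-cong e b))

-- The source of the monicity of `Φ n`, which is the cofactor of one monic polynomial in another.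
monic-cofactor : ∀ {f g n d} h → Monic f n → Monic g d → f ≋ h ⊗ g → ∃[ k ] Monic h k
monic-cofactor {f} {g} {n} {d} h Mf Mg e with d ≤? n
... | no d≰n = contradiction (trans (sym (lead Mf)) (at f≋[] n)) λ ()
  where
  f≋[] : f ≋ []
  f≋[] = ≋-trans e (⊗-congʳ g (short-multiple⇒0 h Mg (degLt-weaken {f} (ℕₚ.≰⇒> d≰n) (bound Mf)) e))
... | yes d≤n with ℕₚ.m≤n⇒∃[o]m+o≡n d≤n
...   | k , refl rewrite ℕₚ.+-comm d k = k , monic (begin
    coeff h k                ≡⟨ ℤₚ.*-identityʳ _ ⟨
    coeff h k ℤ.* + 1        ≡⟨ cong (coeff h k ℤ.*_) (lead Mg) ⟨
    coeff h k ℤ.* coeff g d  ≡⟨ coeff-⊗-top h g b (bound Mg) ⟨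
    coeff (h ⊗ g) (k + d)    ≡⟨ at e (k + d) ⟨
    coeff f (k + d)          ≡⟨ lead Mf ⟩
    + 1 ∎) b
  where
  open ≡-Reasoning
  b : DegLt h (suc k)
  b = degLt-cofactor h (suc k) Mg (degLt-cong e (bound Mf))

-- `divMonic` reads degrees off list lengths; that is sound only for lists whose last entry is
-- nonzero, the shape that `normalize` produces.
data Trimmed : Poly → Set where
  empty : Trimmed []
  ends  : ∀ f {c} → c ≢ + 0 → Trimmed (f ∷ʳ c)

reverse-dropWhile-≋ : ∀ f → reverse (dropWhile (ℤ._≟ + 0) f) ≋ reverse f
reverse-dropWhile-≋ []      = ≋-refl
reverse-dropWhile-≋ (a ∷ f) with a ℤ.≟ + 0
... | yes refl = ≋-trans (reverse-dropWhile-≋ f) (subst (reverse f ≋_) (sym (Listₚ.unfold-reverse (+ 0) f)) trailing)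
  where
  trailing : reverse f ≋ reverse f ∷ʳ + 0
  trailing .at n with n <? length (reverse f)
  ... | yes n< = sym (coeff-++-< (reverse f) _ n<)
  ... | no n≮ with ℕₚ.m≤n⇒∃[o]m+o≡n (ℕₚ.≮⇒≥ n≮)
  ...   | k , refl = trans (degLt-length (reverse f) _ (ℕₚ.m≤m+n _ k))
                           (sym (trans (coeff-++-+ (reverse f) _ k) (at 0∷[]≋[] k)))
... | no _ = ≋-refl

normalize-≋ : ∀ f → normalize f ≋ f
normalize-≋ f = subst (normalize f ≋_) (Listₚ.reverse-involutive f) (reverse-dropWhile-≋ (reverse f))

normalize-trimmed : ∀ f → Trimmed (normalize f)
normalize-trimmed f = go (reverse f)
  where
  go : ∀ g → Trimmed (reverse (dropWhile (ℤ._≟ + 0) g))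
  go []      = empty
  go (a ∷ g) with a ℤ.≟ + 0
  ... | yes _ = go g
  ... | no a≢0 = subst Trimmed (sym (Listₚ.unfold-reverse a g)) (ends (reverse g) a≢0)

coeff-∷ʳ : ∀ f c → coeff (f ∷ʳ c) (length f) ≡ c
coeff-∷ʳ f c = trans (cong (coeff (f ∷ʳ c)) (sym (ℕₚ.+-identityʳ (length f)))) (coeff-++-+ f (c ∷ []) 0)

length-∷ʳ : ∀ f (c : ℤ) → length (f ∷ʳ c) ≡ suc (length f)
length-∷ʳ f c = trans (Listₚ.length-++ f) (ℕₚ.+-comm (length f) 1)

length-trimmed : ∀ {f n} → Trimmed f → DegLt f n → length f ≤ n
length-trimmed empty b = z≤n
length-trimmed {n = n} (ends f {c} c≢0) b with n ≤? length f
... | yes n≤ = contradiction (trans (sym (coeff-∷ʳ f c)) (b (length f) n≤)) c≢0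
... | no n≰  = subst (_≤ n) (sym (length-∷ʳ f c)) (ℕₚ.≰⇒> n≰)

normalize-≋[] : ∀ {f} → f ≋ [] → normalize f ≡ []
normalize-≋[] {f} e with normalize f | normalize-≋ f | normalize-trimmed f
... | []    | _  | _ = refl
... | a ∷ g | e′ | t with length-trimmed {n = 0} t (λ k _ → at (≋-trans e′ e) k)
...   | ()

length-monic : ∀ {f d} → Trimmed f → Monic f d → length f ≡ suc d
length-monic {f} {d} t (monic l b) = ℕₚ.≤-antisym (length-trimmed t b) (ℕₚ.≰⇒> λ len≤d →
  contradiction (trans (sym l) (degLt-length f d len≤d)) λ ())

lc-∷ʳ : ∀ f c → lc (f ∷ʳ c) ≡ c
lc-∷ʳ f c rewrite Listₚ.reverse-++ f (c ∷ []) = refl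

coeff-shift : ∀ k f n → coeff (shift k f) (k + n) ≡ coeff f n
coeff-shift zero    f n = refl
coeff-shift (suc k) f n = coeff-shift k f n

-- Every division step lowers the degree bound by at least one, so `fuel` steps bring a polynomial
-- of degree below `fuel + d` below `d`.
divMonic-spec : ∀ fuel f g {d} → Monic g d → DegLt f (fuel + d) →
                f ≋ proj₁ (divMonic fuel f g) ⊗ g ⊕ proj₂ (divMonic fuel f g) ×
                DegLt (proj₂ (divMonic fuel f g)) d
divMonic-spec zero f g M b = ≋-sym (normalize-≋ f) , degLt-cong (≋-sym (normalize-≋ f)) b
divMonic-spec (suc fuel) f g {d} M b
  with normalize f | normalize-≋ f | normalize-trimmed f
     | normalize g | normalize-≋ g | normalize-trimmed g
... | f′ | f′≋f | tf | g′ | g′≋g | tg with length f′ <? length g′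
...   | yes f′<g′ = ≋-sym f′≋f ,
        degLt-weaken {f′} (ℕₚ.≤-pred (subst (length f′ <_) (length-monic tg (monic-cong (≋-sym g′≋g) M)) f′<g′))
                          (degLt-length f′)
...   | no f′≮g′ = equation , proj₂ ih
  where
  M′ : Monic g′ d
  M′ = monic-cong (≋-sym g′≋g) M

  t = shift (length f′ ∸ length g′) (const (lc f′))
  f″ = f′ ⊖ t ⊗ g′

  -- The leading terms cancel in the subtraction. Since `g′` is trimmed and monic its length is
  -- `suc d`; quantifying over `f′` anew allows its last entry to be exposed by matching.
  drop : ∀ {f′} → Trimmed f′ → suc d ≤ length f′ → DegLt f′ (suc fuel + d) →
         DegLt (f′ ⊖ shift (length f′ ∸ suc d) (const (lc f′)) ⊗ g′) (fuel + d)
  drop empty () b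
  drop (ends f₀ {c} c≢0) d< b rewrite lc-∷ʳ f₀ c | length-∷ʳ f₀ c =
    degLt-weaken {h} (ℕₚ.≤-pred (subst (_≤ suc fuel + d) (length-∷ʳ f₀ c) (length-trimmed (ends f₀ c≢0) b)))
      (degLt-pred {h} (degLt-⊕ {f₀ ∷ʳ c} {negP (u ⊗ g′)}
                         (subst (DegLt (f₀ ∷ʳ c)) (length-∷ʳ f₀ c) (degLt-length (f₀ ∷ʳ c)))
                         (degLt-negP {u ⊗ g′} bound-u))
                      cancel)
    where
    open ≡-Reasoning
    n = length f₀
    k = n ∸ d
    u = shift k (const c)
    h = (f₀ ∷ʳ c) ⊖ u ⊗ g′
    k+d≡n : k + d ≡ n
    k+d≡n = ℕₚ.m∸n+n≡m (ℕₚ.≤-pred d<)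
    degLt-u : DegLt u (suc k)
    degLt-u j k<j with ℕₚ.m≤n⇒∃[o]m+o≡n k<j
    ... | o , refl = trans (cong (coeff u) (sym (ℕₚ.+-suc k o))) (coeff-shift k (const c) (suc o))
    bound-u : DegLt (u ⊗ g′) (suc n)
    bound-u = subst (λ n → DegLt (u ⊗ g′) (suc n)) k+d≡n (degLt-⊗ u g′ degLt-u (bound M′))
    top-u : coeff (u ⊗ g′) n ≡ c
    top-u = begin
      coeff (u ⊗ g′) n         ≡⟨ cong (coeff (u ⊗ g′)) k+d≡n ⟨
      coeff (u ⊗ g′) (k + d)   ≡⟨ coeff-⊗-top u g′ degLt-u (bound M′) ⟩
      coeff u k ℤ.* coeff g′ d ≡⟨ cong₂ ℤ._*_ (trans (cong (coeff u) (sym (ℕₚ.+-identityʳ k))) (coeff-shift k (const c) 0)) (lead M′) ⟩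
      c ℤ.* + 1                ≡⟨ ℤₚ.*-identityʳ c ⟩
      c ∎
    cancel : coeff h n ≡ + 0
    cancel = begin
      coeff h n
        ≡⟨ coeff-⊕ (f₀ ∷ʳ c) (negP (u ⊗ g′)) n ⟩
      coeff (f₀ ∷ʳ c) n ℤ.+ coeff (negP (u ⊗ g′)) n
        ≡⟨ cong₂ ℤ._+_ (coeff-∷ʳ f₀ c) (trans (coeff-negP (u ⊗ g′) n) (cong ℤ.-_ top-u)) ⟩
      c ℤ.+ ℤ.- c
        ≡⟨ ℤₚ.+-inverseʳ c ⟩
      + 0 ∎

  ih = divMonic-spec fuel f″ g′ M′
    (subst (λ l → DegLt (f′ ⊖ shift (length f′ ∸ l) (const (lc f′)) ⊗ g′) (fuel + d))
           (sym (length-monic tg M′))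
           (drop tf (subst (_≤ length f′) (length-monic tg M′) (ℕₚ.≮⇒≥ f′≮g′))
                 (degLt-cong (≋-sym f′≋f) b)))

  q = proj₁ (divMonic fuel f″ g′)
  r = proj₂ (divMonic fuel f″ g′)

  equation : f ≋ (t ⊕ q) ⊗ g ⊕ r
  equation = begin
    f                          ≈⟨ f′≋f ⟨
    f′                         ≈⟨ solve 2 (λ x y → x := (x :- y) :+ y) ≋-refl f′ (t ⊗ g′) ⟩
    f″ ⊕ t ⊗ g′                ≈⟨ ⊕-congʳ (t ⊗ g′) (proj₁ ih) ⟩
    (q ⊗ g′ ⊕ r) ⊕ t ⊗ g′      ≈⟨ solve 4 (λ t q r g → (q :* g :+ r) :+ t :* g := (t :+ q) :* g :+ r) ≋-refl t q r g′ ⟩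
    (t ⊕ q) ⊗ g′ ⊕ r           ≈⟨ ⊕-congʳ r (⊗-congˡ (t ⊕ q) g′≋g) ⟩
    (t ⊕ q) ⊗ g ⊕ r            ∎
    where
    open ≋-Reasoning

-- The remainder is `(h ⊖ q) ⊗ g`, a multiple of a monic polynomial that is shorter than it.
multiple⇒remainder≋[] : ∀ {f g r d} h q → Monic g d → f ≋ h ⊗ g → f ≋ q ⊗ g ⊕ r → DegLt r d → r ≋ []
multiple⇒remainder≋[] {f} {g} {r} h q M e e′ b = ≋-trans r≋ (⊗-congʳ g (short-multiple⇒0 (h ⊖ q) M b r≋))
  where
  open ≋-Reasoning
  r≋ : r ≋ (h ⊖ q) ⊗ g
  r≋ = begin
    r                    ≈⟨ solve 3 (λ q g r → r := (q :* g :+ r) :- q :* g) ≋-refl q g r ⟩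
    (q ⊗ g ⊕ r) ⊖ q ⊗ g  ≈⟨ ⊕-congʳ (negP (q ⊗ g)) (≋-trans (≋-sym e′) e) ⟩
    h ⊗ g ⊖ q ⊗ g        ≈⟨ solve 3 (λ h q g → h :* g :- q :* g := (h :- q) :* g) ≋-refl h q g ⟩
    (h ⊖ q) ⊗ g          ∎

remainder : ∀ f {g d} → Monic g d → ∃[ q ] ∃[ r ] f ≋ q ⊗ g ⊕ r × DegLt r d
remainder f {g} {d} M = proj₁ (divMonic (length f) f g) , proj₂ (divMonic (length f) f g) ,
  divMonic-spec (length f) f g M (degLt-weaken {f} (ℕₚ.m≤m+n (length f) d) (degLt-length f))

module _ {N d : ℕ} (M : Monic (Φ N) d) {f g : Poly} where
  open Defs using () renaming (_≈⟨_⟩_ to _≈⟨_⟩ᴬ_)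

  private
    q = proj₁ (divMonic (length (f ⊖ g)) (f ⊖ g) (Φ N))
    r = proj₂ (divMonic (length (f ⊖ g)) (f ⊖ g) (Φ N))

    spec : f ⊖ g ≋ q ⊗ Φ N ⊕ r × DegLt r d
    spec = divMonic-spec (length (f ⊖ g)) (f ⊖ g) (Φ N) M
      (degLt-weaken {f ⊖ g} (ℕₚ.m≤m+n (length (f ⊖ g)) d) (degLt-length (f ⊖ g)))

  -- The equality of the statement records the outcome of a division; a cofactor is the form in
  -- which it behaves as a ring congruence.
  ≈⟨⟩⇒multiple : f ≈⟨ N ⟩ᴬ g → ∃[ h ] f ≋ g ⊕ h ⊗ Φ N
  ≈⟨⟩⇒multiple e = q , (begin
    f                    ≈⟨ solve 2 (λ f g → f := g :+ (f :- g)) ≋-refl f g ⟩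
    g ⊕ (f ⊖ g)          ≈⟨ ⊕-congˡ g (proj₁ spec) ⟩
    g ⊕ (q ⊗ Φ N ⊕ r)    ≈⟨ ⊕-congˡ g (⊕-congˡ (q ⊗ Φ N) (subst (r ≋_) e (≋-sym (normalize-≋ r)))) ⟩
    g ⊕ (q ⊗ Φ N ⊕ [])   ≈⟨ ⊕-congˡ g (⊕-identityʳ (q ⊗ Φ N)) ⟩
    g ⊕ q ⊗ Φ N          ∎)
    where open ≋-Reasoning

  multiple⇒≈⟨⟩ : ∃[ h ] f ≋ g ⊕ h ⊗ Φ N → f ≈⟨ N ⟩ᴬ g
  multiple⇒≈⟨⟩ (h , e) = normalize-≋[] (multiple⇒remainder≋[] h q M (≋-trans (⊕-congʳ (negP g) e)
    (solve 2 (λ g x → (g :+ x) :- g := x) ≋-refl g (h ⊗ Φ N))) (proj₁ spec) (proj₂ spec))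

-- Cyclotomic polynomials

private module Poly = CommutativeRing polyRing
open import Algebra.Properties.CommutativeSemigroup.Divisibility Poly.*-commutativeSemigroup
  using () renaming (_∣_ to _∣ᴾ_; ∣-trans to ∣ᴾ-trans)
open import Algebra.Definitions.RawMagma Poly.*-rawMagma using (_,_)
private module ∏ᴾ = Products Poly.*-commutativeMonoid

scale-cancel : ∀ {c} f → c ≢ + 0 → const c ⊗ f ≋ [] → f ≋ []
scale-cancel {c} f c≢0 e .at n with ℤₚ.i*j≡0⇒i≡0∨j≡0 c
  (trans (sym (trans (at (const-⊗ c f) n) (coeff-scale c f n))) (at e n))
... | inj₁ c≡0 = contradiction c≡0 c≢0
... | inj₂ z   = z

-- If `r` is the remainder of `f`, then `c r` is the remainder of `c f`, hence zero, and `c`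
-- cancels. This brings divisibility over ℚ back to ℤ.
scale-multiple⇒multiple : ∀ {c f g d} → c ≢ + 0 → Monic g d → g ∣ᴾ const c ⊗ f → g ∣ᴾ f
scale-multiple⇒multiple {c} {f} {g} {d} c≢0 M (k , e) with remainder f M
... | q , r , f≋ , b = q , (begin
  q ⊗ g          ≈⟨ ⊕-identityʳ (q ⊗ g) ⟨
  q ⊗ g ⊕ []     ≈⟨ ⊕-congˡ (q ⊗ g) (scale-cancel r c≢0 (multiple⇒remainder≋[] k (const c ⊗ q) M (≋-sym e) cf≋ cb)) ⟨
  q ⊗ g ⊕ r      ≈⟨ f≋ ⟨
  f              ∎)
  where
  open ≋-Reasoning
  cf≋ : const c ⊗ f ≋ (const c ⊗ q) ⊗ g ⊕ const c ⊗ r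
  cf≋ = ≋-trans (⊗-congˡ (const c) f≋)
    (solve 4 (λ c q g r → c :* (q :* g :+ r) := (c :* q) :* g :+ c :* r) ≋-refl (const c) q g r)
  cb : DegLt (const c ⊗ r) d
  cb = degLt-cong (≋-sym (const-⊗ c r)) (degLt-scale c {r} b)

-- Coprimality over ℚ, stated inside ℤ[x]: some nonzero integer lies in the ideal (f, g).
record Coprimeℚ (f g : Poly) : Set where
  constructor combine
  field
    u v      : Poly
    {value}  : ℤ
    nonzero  : value ≢ + 0
    equation : u ⊗ f ⊕ v ⊗ g ≋ const value

coprimeℚ-sym : ∀ {f g} → Coprimeℚ f g → Coprimeℚ g f
coprimeℚ-sym {f} {g} (combine u v c≢0 e) = combine v u c≢0 (≋-trans (⊕-comm (v ⊗ g) (u ⊗ f)) e)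

coprimeℚ-oneP : ∀ f → Coprimeℚ f oneP
coprimeℚ-oneP f = combine [] oneP {+ 1} (λ ()) (⊗-identityˡ oneP)

coprimeℚ-⊗ : ∀ {f g h} → Coprimeℚ f g → Coprimeℚ f h → Coprimeℚ f (g ⊗ h)
coprimeℚ-⊗ {f} {g} {h} (combine u v {c} c≢0 e) (combine u′ v′ {c′} c′≢0 e′) =
  combine (u ⊗ u′ ⊗ f ⊕ u ⊗ v′ ⊗ h ⊕ v ⊗ u′ ⊗ g) (v ⊗ v′) {c ℤ.* c′}
    (λ z → [ c≢0 , c′≢0 ]′ (ℤₚ.i*j≡0⇒i≡0∨j≡0 c z)) (begin
    (u ⊗ u′ ⊗ f ⊕ u ⊗ v′ ⊗ h ⊕ v ⊗ u′ ⊗ g) ⊗ f ⊕ (v ⊗ v′) ⊗ (g ⊗ h)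
      ≈⟨ solve 7 (λ f g h u v u′ v′ →
           (u :* u′ :* f :+ u :* v′ :* h :+ v :* u′ :* g) :* f :+ (v :* v′) :* (g :* h)
             := (u :* f :+ v :* g) :* (u′ :* f :+ v′ :* h)) ≋-refl f g h u v u′ v′ ⟩
    (u ⊗ f ⊕ v ⊗ g) ⊗ (u′ ⊗ f ⊕ v′ ⊗ h)
      ≈⟨ ⊗-cong e e′ ⟩
    const c ⊗ const c′
      ≈⟨ const-* c c′ ⟨
    const (c ℤ.* c′) ∎)
  where open ≋-Reasoning

-- The Bézout combination shows that `f ⊗ g` divides an integer multiple of `h`; monicity then
-- removes the integer.
coprimeℚ-multiple : ∀ {f g h d} → Monic (f ⊗ g) d → Coprimeℚ f g → f ∣ᴾ h → g ∣ᴾ h → f ⊗ g ∣ᴾ h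
coprimeℚ-multiple {f} {g} {h} M (combine u v {c} c≢0 e) (a , af) (b , bg) =
  scale-multiple⇒multiple c≢0 M (u ⊗ b ⊕ v ⊗ a , (begin
    (u ⊗ b ⊕ v ⊗ a) ⊗ (f ⊗ g)
      ≈⟨ solve 6 (λ f g a b u v → (u :* b :+ v :* a) :* (f :* g) := u :* f :* (b :* g) :+ v :* g :* (a :* f))
           ≋-refl f g a b u v ⟩
    u ⊗ f ⊗ (b ⊗ g) ⊕ v ⊗ g ⊗ (a ⊗ f)
      ≈⟨ ⊕-cong (⊗-congˡ (u ⊗ f) bg) (⊗-congˡ (v ⊗ g) af) ⟩
    u ⊗ f ⊗ h ⊕ v ⊗ g ⊗ h
      ≈⟨ ⊗-distribʳ h (u ⊗ f) (v ⊗ g) ⟨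
    (u ⊗ f ⊕ v ⊗ g) ⊗ h
      ≈⟨ ⊗-congʳ h e ⟩
    const c ⊗ h ∎))
  where open ≋-Reasoning

X^-+ : ∀ m n → X^ (m + n) ≋ X^ m ⊗ X^ n
X^-+ zero    n = ≋-sym (⊗-identityˡ (X^ n))
X^-+ (suc m) n = ≋-trans (∷-cong refl (X^-+ m n)) (≋-sym (0∷-⊗ (X^ m) (X^ n)))

X^-* : ∀ m n → X^ m ^P n ≋ X^ (n * m)
X^-* m zero    = ≋-refl
X^-* m (suc n) = ≋-trans (⊗-congˡ (X^ m) (X^-* m n)) (≋-sym (X^-+ m (n * m)))

geom : Poly → ℕ → Poly
geom y zero    = []
geom y (suc n) = oneP ⊕ y ⊗ geom y n

geom-telescope : ∀ y n → geom y n ⊗ (y ⊖ oneP) ≋ y ^P n ⊖ oneP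
geom-telescope y zero    = ≋-sym (⊕-inverseʳ oneP)
geom-telescope y (suc n) = begin
  (oneP ⊕ y ⊗ geom y n) ⊗ (y ⊖ oneP)
    ≈⟨ solve 2 (λ y s → (con (+ 1) :+ y :* s) :* (y :- con (+ 1))
         := (y :- con (+ 1)) :+ y :* (s :* (y :- con (+ 1)))) ≋-refl y (geom y n) ⟩
  (y ⊖ oneP) ⊕ y ⊗ (geom y n ⊗ (y ⊖ oneP))
    ≈⟨ ⊕-congˡ (y ⊖ oneP) (⊗-congˡ y (geom-telescope y n)) ⟩
  (y ⊖ oneP) ⊕ y ⊗ (y ^P n ⊖ oneP)
    ≈⟨ solve 2 (λ y s → (y :- con (+ 1)) :+ y :* (s :- con (+ 1)) := y :* s :- con (+ 1)) ≋-refl y (y ^P n) ⟩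
  y ^P suc n ⊖ oneP ∎
  where open ≋-Reasoning

-- Every power of `y` is 1 modulo `y ⊖ oneP`. This congruence serves twice: for coprimality of
-- cyclotomic polynomials and for roots of unity close to 1.
geom-const : ∀ y n → ∃[ t ] geom y n ≋ const (+ n) ⊕ t ⊗ (y ⊖ oneP)
geom-const y zero = [] , ≋-sym 0∷[]≋[]
geom-const y (suc n) with geom-const y n
... | t , e = const (+ n) ⊕ y ⊗ t , (begin
  oneP ⊕ y ⊗ geom y n
    ≈⟨ ⊕-congˡ oneP (⊗-congˡ y e) ⟩
  oneP ⊕ y ⊗ (const (+ n) ⊕ t ⊗ (y ⊖ oneP))
    ≈⟨ solve 3 (λ c y t → con (+ 1) :+ y :* (c :+ t :* (y :- con (+ 1)))
         := (con (+ 1) :+ c) :+ (c :+ y :* t) :* (y :- con (+ 1))) ≋-refl (const (+ n)) y t ⟩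
  const (+ suc n) ⊕ (const (+ n) ⊕ y ⊗ t) ⊗ (y ⊖ oneP) ∎)
  where open ≋-Reasoning

X^-1 : ℕ → Poly
X^-1 n = X^ n ⊖ oneP

X^-1-monic : ∀ {n} → 1 ≤ n → Monic (X^-1 n) n
X^-1-monic {suc n} _ = monic lead-X (degLt-⊕ {X^ (suc n)} {negP oneP} bound-X λ { (suc k) _ → refl })
  where
  lead-X : coeff (X^-1 (suc n)) (suc n) ≡ + 1
  lead-X = trans (coeff-⊕ (X^ (suc n)) (negP oneP) (suc n))
    (trans (ℤₚ.+-identityʳ _) (trans (cong (coeff (X^ n)) (sym (ℕₚ.+-identityʳ n))) (coeff-shift n oneP 0)))
  bound-X : DegLt (X^ (suc n)) (suc (suc n))
  bound-X k n<k with ℕₚ.m≤n⇒∃[o]m+o≡n n<k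
  ... | o , refl = trans (cong (coeff (X^ n)) (sym (ℕₚ.+-suc n o))) (coeff-shift n oneP (suc o))

geom-X^ : ∀ g k → geom (X^ g) k ⊗ X^-1 g ≋ X^-1 (k * g)
geom-X^ g k = ≋-trans (geom-telescope (X^ g) k) (⊕-congʳ (negP oneP) (X^-* g k))

∣⇒X^-1∣ : ∀ {d n} → d ∣ n → X^-1 d ∣ᴾ X^-1 n
∣⇒X^-1∣ {d} (divides k refl) = geom (X^ d) k , geom-X^ d k

-- A subtractive Euclidean step on exponents: x^k - 1 = (x^(k+n) - 1) - x^k (x^n - 1).
X^-1-difference : ∀ {f g} k m n → k + n ≡ m → f ∣ᴾ X^-1 m → g ∣ᴾ X^-1 n →
                  ∃[ u ] ∃[ v ] u ⊗ f ⊕ v ⊗ g ≋ X^-1 k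
X^-1-difference {f} {g} k m n refl (a , af) (b , bg) = a , negP (X^ k ⊗ b) , (begin
  a ⊗ f ⊕ negP (X^ k ⊗ b) ⊗ g
    ≈⟨ solve 4 (λ x z b g → z :+ (:- (x :* b)) :* g := z :- x :* (b :* g)) ≋-refl (X^ k) (a ⊗ f) b g ⟩
  a ⊗ f ⊖ X^ k ⊗ (b ⊗ g)
    ≈⟨ ⊕-cong af (negP-cong (⊗-congˡ (X^ k) bg)) ⟩
  X^-1 (k + n) ⊖ X^ k ⊗ X^-1 n
    ≈⟨ ⊕-congʳ (negP (X^ k ⊗ X^-1 n)) (⊕-congʳ (negP oneP) (X^-+ k n)) ⟩
  (X^ k ⊗ X^ n ⊖ oneP) ⊖ X^ k ⊗ X^-1 n
    ≈⟨ solve 2 (λ x y → (x :* y :- con (+ 1)) :- x :* (y :- con (+ 1)) := x :- con (+ 1)) ≋-refl (X^ k) (X^ n) ⟩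
  X^-1 k ∎)
  where open ≋-Reasoning

-- Bézout over the naturals writes the gcd as a difference of a multiple of `d` and a multiple of
-- `e`, in one order or the other, so a single subtractive step reaches it.
X^-1-gcd : ∀ {f g} d e → f ∣ᴾ X^-1 d → g ∣ᴾ X^-1 e →
           ∃[ u ] ∃[ v ] u ⊗ f ⊕ v ⊗ g ≋ X^-1 (gcd d e)
X^-1-gcd {f} {g} d e f∣ g∣ with Bézout.identity (gcd-GCD d e)
... | Bézout.+- x y eq = X^-1-difference (gcd d e) (x * d) (y * e) eq
        (∣ᴾ-trans f∣ (∣⇒X^-1∣ (divides x refl))) (∣ᴾ-trans g∣ (∣⇒X^-1∣ (divides y refl)))
... | Bézout.-+ x y eq with X^-1-difference (gcd d e) (y * e) (x * d) eq
        (∣ᴾ-trans g∣ (∣⇒X^-1∣ (divides y refl))) (∣ᴾ-trans f∣ (∣⇒X^-1∣ (divides x refl)))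
...   | v , u , eq′ = u , v , ≋-trans (⊕-comm (u ⊗ f) (v ⊗ g)) eq′

properDivs⁻ : ∀ {d n} → d ∈ properDivs n → 1 ≤ d × d < n × d ∣ n
properDivs⁻ {n = n} d∈ with ∈-filter⁻ (λ d → d ℕD.∣? n) {xs = filter (λ d → 1 ≤? d) (upTo n)} d∈
... | d∈′ , d∣n with ∈-filter⁻ (λ d → 1 ≤? d) {xs = upTo n} d∈′
...   | d∈″ , 1≤d = 1≤d , ∈-upTo⁻ d∈″ , d∣n

properDivs⁺ : ∀ {d n} → 1 ≤ d → d < n → d ∣ n → d ∈ properDivs n
properDivs⁺ {n = n} 1≤d d<n d∣n = ∈-filter⁺ (λ d → d ℕD.∣? n) (∈-filter⁺ (λ d → 1 ≤? d) (∈-upTo⁺ d<n) 1≤d) d∣n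

properDivs-unique : ∀ n → Unique (properDivs n)
properDivs-unique n = Uniqueₚ.filter⁺ (λ d → d ℕD.∣? n) (Uniqueₚ.filter⁺ (λ d → 1 ≤? d) (Uniqueₚ.upTo⁺ n))

-- The recursion descends to proper divisors, which are smaller, so any fuel above `n` gives the
-- same polynomial. This identifies the inner calls of `cyc` with `Φ`.
cyc-fuel : ∀ k l {n} → n < k → n < l → cyc k n ≡ cyc l n
cyc-fuel (suc k) (suc l) {n} (s≤s n≤k) (s≤s n≤l) =
  cong (λ fs → proj₁ (divMonic (suc n) (X^-1 n) (prodP fs))) (Listₚ.map-cong-local (All.tabulate λ d∈ →
    let _ , d<n , _ = properDivs⁻ d∈ in
    cyc-fuel k l (ℕₚ.<-≤-trans d<n n≤k) (ℕₚ.<-≤-trans d<n n≤l)))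

properΦ : ℕ → Poly
properΦ n = prodP (map Φ (properDivs n))

Φ-quotient : ∀ n → Φ n ≡ proj₁ (divMonic (suc n) (X^-1 n) (properΦ n))
Φ-quotient n = cong (λ fs → proj₁ (divMonic (suc n) (X^-1 n) (prodP fs))) (Listₚ.map-cong-local (All.tabulate λ {d} d∈ →
  let _ , d<n , _ = properDivs⁻ d∈ in cyc-fuel n (suc d) d<n (ℕₚ.n<1+n d)))

record Cyclotomic (n : ℕ) : Set where
  field
    degree        : ℕ
    Φ-monic       : Monic (Φ n) degree
    factorisation : X^-1 n ≋ Φ n ⊗ properΦ n

  Φ∣X^-1 : Φ n ∣ᴾ X^-1 n
  Φ∣X^-1 = properΦ n , ≋-trans (⊗-comm (properΦ n) (Φ n)) (≋-sym factorisation)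

open Cyclotomic

-- The divisors of `g`, including `g`, are distinct proper divisors of `n`, and the product of their
-- cyclotomic polynomials is x^g - 1.
X^-1∣properΦ : ∀ {g n} → Cyclotomic g → 1 ≤ g → g < n → g ∣ n → X^-1 g ∣ᴾ properΦ n
X^-1∣properΦ {g} {n} C 1≤g g<n g∣n with unique-⊆⇒↭ {ys = g ∷ properDivs g}
  (All.tabulate (λ d∈ → ≢-sym (ℕₚ.<⇒≢ (proj₁ (proj₂ (properDivs⁻ d∈))))) ∷ properDivs-unique g)
  (λ { (here refl) → properDivs⁺ 1≤g g<n g∣n
     ; (there d∈)  → let 1≤d , d<g , d∣g = properDivs⁻ d∈ in
                     properDivs⁺ 1≤d (ℕₚ.<-trans d<g g<n) (ℕD.∣-trans d∣g g∣n) })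
... | zs , perm = ∏ᴾ.∏ Φ zs , (begin
  ∏ᴾ.∏ Φ zs ⊗ X^-1 g                     ≈⟨ ⊗-comm (∏ᴾ.∏ Φ zs) (X^-1 g) ⟩
  X^-1 g ⊗ ∏ᴾ.∏ Φ zs                     ≈⟨ ⊗-congʳ (∏ᴾ.∏ Φ zs) (factorisation C) ⟩
  ∏ᴾ.∏ Φ (g ∷ properDivs g) ⊗ ∏ᴾ.∏ Φ zs   ≈⟨ ∏ᴾ.∏-++ Φ (g ∷ properDivs g) zs ⟨
  ∏ᴾ.∏ Φ (g ∷ properDivs g ++ zs)         ≈⟨ ∏ᴾ.∏-↭ Φ perm ⟨
  properΦ n                               ∎)
  where open ≋-Reasoning

⊗-cancelʳ-monic : ∀ {f h g d} → Monic g d → f ⊗ g ≋ h ⊗ g → f ≋ h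
⊗-cancelʳ-monic {f} {h} {g} M e = begin
  f              ≈⟨ solve 2 (λ f h → f := (f :- h) :+ h) ≋-refl f h ⟩
  (f ⊖ h) ⊕ h    ≈⟨ ⊕-congʳ h (short-multiple⇒0 {[]} (f ⊖ h) M (λ _ _ → refl) (≋-sym (begin
    (f ⊖ h) ⊗ g      ≈⟨ solve 3 (λ f h g → (f :- h) :* g := f :* g :- h :* g) ≋-refl f h g ⟩
    f ⊗ g ⊖ h ⊗ g    ≈⟨ ⊕-congʳ (negP (h ⊗ g)) e ⟩
    h ⊗ g ⊖ h ⊗ g    ≈⟨ ⊕-inverseʳ (h ⊗ g) ⟩
    []               ∎))) ⟩
  h              ∎
  where open ≋-Reasoning

-- Write x^n - 1 both as `Φ n ⊗ properΦ n` and as the geometric sum times x^g - 1, then cancel x^g -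
-- 1, which divides `properΦ n`.
Φ∣geom : ∀ {g k} → Cyclotomic g → Cyclotomic (k * g) → 1 ≤ g → g < k * g → Φ (k * g) ∣ᴾ geom (X^ g) k
Φ∣geom {g} {k} C C′ 1≤g g<n with X^-1∣properΦ C 1≤g g<n (divides k refl)
... | h , e = h , ⊗-cancelʳ-monic (X^-1-monic 1≤g) (begin
  (h ⊗ Φ n) ⊗ X^-1 g      ≈⟨ solve 3 (λ h f x → (h :* f) :* x := f :* (h :* x)) ≋-refl h (Φ n) (X^-1 g) ⟩
  Φ n ⊗ (h ⊗ X^-1 g)      ≈⟨ ⊗-congˡ (Φ n) e ⟩
  Φ n ⊗ properΦ n          ≈⟨ factorisation C′ ⟨
  X^-1 n                  ≈⟨ geom-X^ g k ⟨
  geom (X^ g) k ⊗ X^-1 g  ∎)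
  where
  open ≋-Reasoning
  n = k * g

-- The value k of 1 + y + ⋯ + y^(k-1) at y = 1 is then a nonzero integer in the ideal (f, g).
geom-coprimeℚ : ∀ {f g y k} a b → k ≢ 0 → f ∣ᴾ geom y k → a ⊗ f ⊕ b ⊗ g ≋ y ⊖ oneP → Coprimeℚ f g
geom-coprimeℚ {f} {g} {y} {k} a b k≢0 (h , h≋) e with geom-const y k
... | t , t≋ = combine (h ⊖ t ⊗ a) (negP (t ⊗ b)) {+ k} (λ z → k≢0 (ℤₚ.+-injective z)) (begin
  (h ⊖ t ⊗ a) ⊗ f ⊕ negP (t ⊗ b) ⊗ g
    ≈⟨ solve 6 (λ h t a b f g → (h :- t :* a) :* f :+ (:- (t :* b)) :* g
         := h :* f :- t :* (a :* f :+ b :* g)) ≋-refl h t a b f g ⟩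
  h ⊗ f ⊖ t ⊗ (a ⊗ f ⊕ b ⊗ g)
    ≈⟨ ⊕-cong (≋-trans h≋ t≋) (negP-cong (⊗-congˡ t e)) ⟩
  (const (+ k) ⊕ t ⊗ (y ⊖ oneP)) ⊖ t ⊗ (y ⊖ oneP)
    ≈⟨ solve 2 (λ c x → (c :+ x) :- x := c) ≋-refl (const (+ k)) (t ⊗ (y ⊖ oneP)) ⟩
  const (+ k) ∎)
  where open ≋-Reasoning

-- Take y = x^g with g the gcd, and k = d/g. The ideal of the two polynomials contains y - 1, and
-- strictness of g < d puts the geometric sum of y there too.
Φ-coprime-gcd< : ∀ {d e} → Cyclotomic (gcd d e) → Cyclotomic d → Cyclotomic e →
                 1 ≤ gcd d e → gcd d e < d → Coprimeℚ (Φ d) (Φ e)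
Φ-coprime-gcd< {d} {e} Cg Cd Ce 1≤g g<d
  with gcd d e | gcd[m,n]∣m d e | X^-1-gcd d e (Φ∣X^-1 Cd) (Φ∣X^-1 Ce)
... | g | divides k refl | a , b , g≋ = geom-coprimeℚ a b k≢0 (Φ∣geom {g} {k} Cg Cd 1≤g g<d) g≋
  where
  k≢0 : k ≢ 0
  k≢0 refl = contradiction g<d λ ()

module _ {n : ℕ} (1≤n : 1 ≤ n) (C : ∀ {d} → d < n → 1 ≤ d → Cyclotomic d) where

  private
    -- Distinct indices cannot both equal their gcd, so the strict inequality holds for one of them;
    -- the roles are exchanged when `d` is the gcd.
    coprime : ∀ {d e} → 1 ≤ d → 1 ≤ e → d < n → e < n → d ≢ e → Coprimeℚ (Φ d) (Φ e)
    coprime {d} {e} 1≤d 1≤e d<n e<n d≢e with gcd d e ℕₚ.≟ d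
    ... | no g≢d = Φ-coprime-gcd< (C (ℕₚ.≤-<-trans g≤d d<n) 1≤g) (C d<n 1≤d) (C e<n 1≤e) 1≤g (ℕₚ.≤∧≢⇒< g≤d g≢d)
      where
      instance _ = ℕ.>-nonZero 1≤d
      g≤d = ℕD.∣⇒≤ (gcd[m,n]∣m d e)
      1≤g = ℕₚ.n≢0⇒n>0 (gcd[m,n]≢0 d e (inj₁ (ℕₚ.>⇒≢ 1≤d)))
    ... | yes g≡d = coprimeℚ-sym (Φ-coprime-gcd< (C (ℕₚ.≤-<-trans g≤e e<n) 1≤g) (C e<n 1≤e) (C d<n 1≤d) 1≤g
                      (ℕₚ.≤∧≢⇒< g≤e λ g≡e → d≢e (trans (sym g≡d) (trans (gcd-comm d e) g≡e))))
      where
      instance _ = ℕ.>-nonZero 1≤e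
      g≤e = ℕD.∣⇒≤ (gcd[m,n]∣m e d)
      1≤g = ℕₚ.n≢0⇒n>0 (gcd[m,n]≢0 e d (inj₁ (ℕₚ.>⇒≢ 1≤e)))

    coprime-∏ : ∀ f ds → (∀ {e} → e ∈ ds → Coprimeℚ f (Φ e)) → Coprimeℚ f (∏ᴾ.∏ Φ ds)
    coprime-∏ f []       c = coprimeℚ-oneP f
    coprime-∏ f (e ∷ ds) c = coprimeℚ-⊗ (c (here refl)) (coprime-∏ f ds λ e∈ → c (there e∈))

    -- Monicity is carried through the induction because combining coprime divisors over ℤ requires
    -- it.
    ∏-divides : ∀ ds → Unique ds → (∀ {d} → d ∈ ds → 1 ≤ d × d < n × d ∣ n) →
                (∃[ k ] Monic (∏ᴾ.∏ Φ ds) k) × ∏ᴾ.∏ Φ ds ∣ᴾ X^-1 n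
    ∏-divides [] _ _ = (0 , monic-oneP) , (X^-1 n , Poly.*-identityʳ (X^-1 n))
    ∏-divides (d ∷ ds) (d∉ ∷ u) p with p (here refl) | ∏-divides ds u (λ e∈ → p (there e∈))
    ... | 1≤d , d<n , d∣n | (k , M) , div = (_ , M′) , coprimeℚ-multiple M′
      (coprime-∏ (Φ d) ds λ e∈ → let 1≤e , e<n , _ = p (there e∈) in coprime 1≤d 1≤e d<n e<n (All.lookup d∉ e∈))
      (∣ᴾ-trans (Φ∣X^-1 (C d<n 1≤d)) (∣⇒X^-1∣ d∣n)) div
      where M′ = monic-⊗ (Φ-monic (C d<n 1≤d)) M

  cyclotomic-step : Cyclotomic n
  cyclotomic-step with ∏-divides (properDivs n) (properDivs-unique n) properDivs⁻
  ... | (k , M) , (h , h≋) with divMonic-spec (suc n) (X^-1 n) (properΦ n) M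
        (degLt-weaken {X^-1 n} (ℕₚ.m≤m+n (suc n) k) (bound (X^-1-monic 1≤n)))
  ...   | e , b = record
    { degree        = proj₁ M′
    ; Φ-monic       = proj₂ M′
    ; factorisation = fact
    }
    where
    open ≋-Reasoning
    r = proj₂ (divMonic (suc n) (X^-1 n) (properΦ n))
    e′ : X^-1 n ≋ Φ n ⊗ properΦ n ⊕ r
    e′ = subst (λ q → X^-1 n ≋ q ⊗ properΦ n ⊕ r) (sym (Φ-quotient n)) e
    fact : X^-1 n ≋ Φ n ⊗ properΦ n
    fact = begin
      X^-1 n               ≈⟨ e′ ⟩
      Φ n ⊗ properΦ n ⊕ r   ≈⟨ ⊕-congˡ (Φ n ⊗ properΦ n) (multiple⇒remainder≋[] h (Φ n) M (≋-sym h≋) e′ b) ⟩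
      Φ n ⊗ properΦ n ⊕ []  ≈⟨ ⊕-identityʳ (Φ n ⊗ properΦ n) ⟩
      Φ n ⊗ properΦ n       ∎
    M′ = monic-cofactor (Φ n) (X^-1-monic 1≤n) M fact

cyclotomic : ∀ n → 1 ≤ n → Cyclotomic n
cyclotomic = <-rec (λ n → 1 ≤ n → Cyclotomic n) λ n ih 1≤n → cyclotomic-step 1≤n (λ d<n 1≤d → ih d<n 1≤d)

-- Quotient rings and Gauss's lemma

module Quotient (R : CommutativeRing 0ℓ 0ℓ) (d : CommutativeRing.Carrier R) where
  open CommutativeRing R
    renaming (_+_ to _⊞_; _*_ to _⊠_; -_ to ⊟_; refl to ≈-refl; sym to ≈-sym; trans to ≈-trans; reflexive to ≈-reflexive)
  open NaturalSolver commutativeSemiring using ()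
    renaming (solve to solveᴿ; con to conᴿ; _:+_ to _+ᴿ_; _:*_ to _*ᴿ_; _:=_ to _=ᴿ_)
  open RingProperties ring using (-‿distribˡ-*; -‿+-comm)
  open Relation.Binary.Reasoning.Setoid setoid

  infix 4 _≈/_
  infix 3 _by_

  -- The multiplier is kept as data: `symbol` carries that of 2^q ≡ ±1 from ℤ into ℤ[x], and the
  -- final conversion uses it as the cofactor of `Φ N`.
  record _≈/_ (x y : Carrier) : Set where
    constructor _by_
    field
      multiplier : Carrier
      equality   : x ≈ y ⊞ multiplier ⊠ d

  lift : ∀ {x y} → x ≈ y → x ≈/ y
  lift {x} {y} e = 0# by ≈-trans e (solveᴿ 2 (λ y d → y =ᴿ y +ᴿ conᴿ 0 *ᴿ d) ≈-refl y d)

  private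
    ≈/-sym : ∀ {x y} → x ≈/ y → y ≈/ x
    ≈/-sym {x} {y} (h by e) = ⊟ h by ≈-sym (begin
      x ⊞ ⊟ h ⊠ d              ≈⟨ +-congʳ e ⟩
      (y ⊞ h ⊠ d) ⊞ ⊟ h ⊠ d    ≈⟨ solveᴿ 4 (λ y h h′ d → (y +ᴿ h *ᴿ d) +ᴿ h′ *ᴿ d =ᴿ y +ᴿ (h +ᴿ h′) *ᴿ d) ≈-refl y h (⊟ h) d ⟩
      y ⊞ (h ⊞ ⊟ h) ⊠ d        ≈⟨ +-congˡ (*-congʳ (-‿inverseʳ h)) ⟩
      y ⊞ 0# ⊠ d               ≈⟨ solveᴿ 2 (λ y d → y +ᴿ conᴿ 0 *ᴿ d =ᴿ y) ≈-refl y d ⟩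
      y                        ∎)

    ≈/-trans : ∀ {x y z} → x ≈/ y → y ≈/ z → x ≈/ z
    ≈/-trans {x} {y} {z} (h by e) (k by e′) = k ⊞ h by (begin
      x                    ≈⟨ e ⟩
      y ⊞ h ⊠ d            ≈⟨ +-congʳ e′ ⟩
      (z ⊞ k ⊠ d) ⊞ h ⊠ d  ≈⟨ solveᴿ 4 (λ z h k d → (z +ᴿ k *ᴿ d) +ᴿ h *ᴿ d =ᴿ z +ᴿ (k +ᴿ h) *ᴿ d) ≈-refl z h k d ⟩
      z ⊞ (k ⊞ h) ⊠ d      ∎)

    ≈/-+ : ∀ {x x′ y y′} → x ≈/ x′ → y ≈/ y′ → x ⊞ y ≈/ x′ ⊞ y′
    ≈/-+ {x} {x′} {y} {y′} (h by e) (k by e′) = h ⊞ k by ≈-trans (+-cong e e′)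
      (solveᴿ 5 (λ x h y k d → (x +ᴿ h *ᴿ d) +ᴿ (y +ᴿ k *ᴿ d) =ᴿ (x +ᴿ y) +ᴿ (h +ᴿ k) *ᴿ d) ≈-refl x′ h y′ k d)

    ≈/-* : ∀ {x x′ y y′} → x ≈/ x′ → y ≈/ y′ → x ⊠ y ≈/ x′ ⊠ y′
    ≈/-* {x} {x′} {y} {y′} (h by e) (k by e′) = x′ ⊠ k ⊞ h ⊠ y′ ⊞ h ⊠ k ⊠ d by ≈-trans (*-cong e e′)
      (solveᴿ 5 (λ x h y k d → (x +ᴿ h *ᴿ d) *ᴿ (y +ᴿ k *ᴿ d)
        =ᴿ x *ᴿ y +ᴿ (x *ᴿ k +ᴿ h *ᴿ y +ᴿ h *ᴿ k *ᴿ d) *ᴿ d) ≈-refl x′ h y′ k d)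

    ≈/-neg : ∀ {x y} → x ≈/ y → ⊟ x ≈/ ⊟ y
    ≈/-neg {x} {y} (h by e) = ⊟ h by (begin
      ⊟ x                ≈⟨ -‿cong e ⟩
      ⊟ (y ⊞ h ⊠ d)      ≈⟨ -‿+-comm y (h ⊠ d) ⟨
      ⊟ y ⊞ ⊟ (h ⊠ d)    ≈⟨ +-congˡ (-‿distribˡ-* h d) ⟩
      ⊟ y ⊞ ⊟ h ⊠ d      ∎)

  commutativeRing/ : CommutativeRing 0ℓ 0ℓ
  commutativeRing/ = record
    { Carrier = Carrier ; _≈_ = _≈/_ ; _+_ = _⊞_ ; _*_ = _⊠_ ; -_ = ⊟_ ; 0# = 0# ; 1# = 1#
    ; isCommutativeRing = record
      { isRing = record
        { +-isAbelianGroup = record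
          { isGroup = record
            { isMonoid = record
              { isSemigroup = record
                { isMagma = record
                  { isEquivalence = record { refl = lift ≈-refl ; sym = ≈/-sym ; trans = ≈/-trans }
                  ; ∙-cong = ≈/-+ }
                ; assoc = λ x y z → lift (+-assoc x y z) }
              ; identity = (λ x → lift (+-identityˡ x)) , λ x → lift (+-identityʳ x) }
            ; inverse = (λ x → lift (-‿inverseˡ x)) , λ x → lift (-‿inverseʳ x)
            ; ⁻¹-cong = ≈/-neg }
          ; comm = λ x y → lift (+-comm x y) }
        ; *-cong = ≈/-*
        ; *-assoc = λ x y z → lift (*-assoc x y z)
        ; *-identity = (λ x → lift (*-identityˡ x)) , λ x → lift (*-identityʳ x)
        ; distrib = (λ x y z → lift (distribˡ x y z)) , λ x y z → lift (distribʳ x y z) }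
      ; *-comm = λ x y → lift (*-comm x y) } }

module Cancellation (R : CommutativeRing 0ℓ 0ℓ) where
  open CommutativeRing R
    renaming (_+_ to _⊞_; _*_ to _⊠_; -_ to ⊟_; refl to ≈-refl; sym to ≈-sym; trans to ≈-trans; reflexive to ≈-reflexive)
  open Products *-commutativeMonoid

  Cancellable : Carrier → Set
  Cancellable x = ∀ {y z} → x ⊠ y ≈ x ⊠ z → y ≈ z

  ⊠-cancellable : ∀ {x y} → Cancellable x → Cancellable y → Cancellable (x ⊠ y)
  ⊠-cancellable c c′ e = c′ (c (≈-trans (≈-sym (*-assoc _ _ _)) (≈-trans e (*-assoc _ _ _))))

  ∏-cancellable : ∀ {A : Set} {f : A → Carrier} xs → (∀ {x} → x ∈ xs → Cancellable (f x)) → Cancellable (∏ f xs)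
  ∏-cancellable []       c e = ≈-trans (≈-sym (*-identityˡ _)) (≈-trans e (*-identityˡ _))
  ∏-cancellable (x ∷ xs) c   = ⊠-cancellable (c (here refl)) (∏-cancellable xs (λ x∈ → c (there x∈)))

-- L is a half system of residues modulo p stable under ±2.  U h = h and V h = 2 give Gauss's lemma;
-- U h = ζ^h − ζ^(−h) and V h = ζ^h + ζ^(−h) evaluate the product in ℤ[ζ].
module Gauss (p : ℕ) (L : List ℕ) where

  -- For h < p/2 this is the absolute value of the least absolute residue of 2h modulo p, and `flip`
  -- records whether that residue is negative.
  fold : ℕ → ℕ
  fold h with 2 * (2 * h) <? p
  ... | yes _ = 2 * h
  ... | no _  = p ∸ 2 * h

  flip : ℕ → ℕ
  flip h with 2 * (2 * h) <? p
  ... | yes _ = 0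
  ... | no _  = 1

  flips : ℕ
  flips = sum (map flip L)

  module _ (R : CommutativeRing 0ℓ 0ℓ) where
    open CommutativeRing R
      renaming (_+_ to _⊞_; _*_ to _⊠_; -_ to ⊟_; refl to ≈-refl; sym to ≈-sym; trans to ≈-trans; reflexive to ≈-reflexive)
    open Products *-commutativeMonoid
    open Cancellation R
    open Exponentiation semiring using (_^_; ^-homo-*)
    open RingProperties ring using (-1*x≈-x)
    open Relation.Binary.Reasoning.Setoid setoid

    -- Each `V h ⊠ U h` is `U (fold h)` up to sign, and `fold` permutes `L`, so the product of `U`
    -- cancels. The exponent `flips` depends on `p` and `L` alone; this is why the integer
    -- congruence and the product of roots of unity share one sign.
    gauss : (U V : ℕ → Carrier) → map fold L ↭ L →
            (∀ {h} → h ∈ L → U (2 * h) ≈ V h ⊠ U h) →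
            (∀ {h} → h ∈ L → U (p ∸ 2 * h) ≈ ⊟ U (2 * h)) →
            (∀ {h} → h ∈ L → Cancellable (U h)) →
            ∏ V L ≈ (⊟ 1#) ^ flips
    gauss U V perm double reflect cancel = ∏-cancellable L cancel (begin
      ∏ U L ⊠ ∏ V L                         ≈⟨ *-comm (∏ U L) (∏ V L) ⟩
      ∏ V L ⊠ ∏ U L                         ≈⟨ ∏-∙ V U L ⟨
      ∏ (λ h → V h ⊠ U h) L                 ≈⟨ ∏-cong L (λ {h} h∈ → step h∈) ⟩
      ∏ (λ h → (⊟ 1#) ^ flip h ⊠ U (fold h)) L
        ≈⟨ ∏-∙ (λ h → (⊟ 1#) ^ flip h) (λ h → U (fold h)) L ⟩
      ∏ (λ h → (⊟ 1#) ^ flip h) L ⊠ ∏ (λ h → U (fold h)) L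
        ≈⟨ *-cong (signs L) (≈-reflexive (sym (∏-map U fold L))) ⟩
      (⊟ 1#) ^ flips ⊠ ∏ U (map fold L)     ≈⟨ *-congˡ (∏-↭ U perm) ⟩
      (⊟ 1#) ^ flips ⊠ ∏ U L                ≈⟨ *-comm _ (∏ U L) ⟩
      ∏ U L ⊠ (⊟ 1#) ^ flips                ∎)
      where
      signs : ∀ xs → ∏ (λ h → (⊟ 1#) ^ flip h) xs ≈ (⊟ 1#) ^ sum (map flip xs)
      signs []       = ≈-refl
      signs (x ∷ xs) = ≈-trans (*-congˡ (signs xs)) (≈-sym (^-homo-* (⊟ 1#) (flip x) (sum (map flip xs))))
      step : ∀ {h} → h ∈ L → V h ⊠ U h ≈ (⊟ 1#) ^ flip h ⊠ U (fold h)
      step {h} h∈ with 2 * (2 * h) <? p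
      ... | yes _ = ≈-trans (≈-sym (double h∈)) (≈-sym (*-identityˡ (U (2 * h))))
      ... | no _  = begin
        V h ⊠ U h                         ≈⟨ double h∈ ⟨
        U (2 * h)                         ≈⟨ -‿involutive (U (2 * h)) ⟨
        ⊟ (⊟ U (2 * h))                   ≈⟨ -‿cong (reflect h∈) ⟨
        ⊟ U (p ∸ 2 * h)                   ≈⟨ -1*x≈-x (U (p ∸ 2 * h)) ⟨
        ⊟ 1# ⊠ U (p ∸ 2 * h)              ≈⟨ *-congʳ (*-identityʳ (⊟ 1#)) ⟨
        (⊟ 1# ⊠ 1#) ⊠ U (p ∸ 2 * h)       ∎
        where open RingProperties ring using (-‿involutive)

-- Arithmetic modulo p

-- A list c₀ ∷ ⋯ ∷ cₙ₋₁ ∷ [] stands here for the monic polynomial xⁿ + cₙ₋₁ xⁿ⁻¹ + ⋯ + c₀.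
evalMonic : List ℤ → ℤ → ℤ
evalMonic []      x = + 1
evalMonic (c ∷ f) x = c ℤ.+ x ℤ.* evalMonic f x

-- Synthetic division by x - r. The leading 1 is implicit, so the quotient of x + c is the empty
-- list, the constant 1.
deflate : ℤ → List ℤ → List ℤ
deflate r []              = []
deflate r (c ∷ [])        = []
deflate r (c ∷ f@(_ ∷ _)) = evalMonic f r ∷ deflate r f

length-deflate : ∀ r c f → length (deflate r (c ∷ f)) ≡ length f
length-deflate r c []      = refl
length-deflate r c (d ∷ f) = cong suc (length-deflate r d f)

evalMonic-deflate : ∀ r c f x →
  evalMonic (c ∷ f) x ≡ evalMonic (c ∷ f) r ℤ.+ (x ℤ.- r) ℤ.* evalMonic (deflate r (c ∷ f)) x
evalMonic-deflate r c [] x =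
  solveℤ 3 (λ c x r → c +ℤ x *ℤ conℤ (+ 1) =ℤ (c +ℤ r *ℤ conℤ (+ 1)) +ℤ (x -ℤ r) *ℤ conℤ (+ 1)) refl c x r
evalMonic-deflate r c f@(d ∷ f′) x = begin
  c ℤ.+ x ℤ.* evalMonic f x
    ≡⟨ cong (λ e → c ℤ.+ x ℤ.* e) (evalMonic-deflate r d f′ x) ⟩
  c ℤ.+ x ℤ.* (e ℤ.+ (x ℤ.- r) ℤ.* s)
    ≡⟨ solveℤ 5 (λ c x r e s → c +ℤ x *ℤ (e +ℤ (x -ℤ r) *ℤ s)
         =ℤ (c +ℤ r *ℤ e) +ℤ (x -ℤ r) *ℤ (e +ℤ x *ℤ s)) refl c x r e s ⟩
  (c ℤ.+ r ℤ.* e) ℤ.+ (x ℤ.- r) ℤ.* (e ℤ.+ x ℤ.* s) ∎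
  where
  open ≡-Reasoning
  e = evalMonic f r
  s = evalMonic (deflate r f) x

evalMonic-binomial : ∀ c n x → evalMonic (ℤ.- c ∷ replicate n (+ 0)) x ≡ x ℤ.^ suc n ℤ.- c
evalMonic-binomial c n x = trans (cong (λ e → ℤ.- c ℤ.+ x ℤ.* e) (go n)) (ℤₚ.+-comm (ℤ.- c) _)
  where
  go : ∀ n → evalMonic (replicate n (+ 0)) x ≡ x ℤ.^ n
  go zero    = refl
  go (suc n) = trans (ℤₚ.+-identityˡ _) (cong (x ℤ.*_) (go n))

*-^-distrib : ∀ x y n → (x ℤ.* y) ℤ.^ n ≡ x ℤ.^ n ℤ.* y ℤ.^ n
*-^-distrib x y zero    = refl
*-^-distrib x y (suc n) = trans (cong (x ℤ.* y ℤ.*_) (*-^-distrib x y n))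
  (solveℤ 4 (λ x y a b → (x *ℤ y) *ℤ (a *ℤ b) =ℤ (x *ℤ a) *ℤ (y *ℤ b)) refl x y (x ℤ.^ n) (y ℤ.^ n))

+-∸ : ∀ {m n} → n ≤ m → + (m ∸ n) ≡ + m ℤ.- + n
+-∸ {m} {n} n≤m = sym (trans (ℤₚ.m-n≡m⊖n m n) (ℤₚ.⊖-≥ n≤m))

module Prime-field {p : ℕ} (p-prime : Prime p) where

  open Quotient ℤₚ.+-*-commutativeRing (+ p) public
    using (_by_; lift) renaming (_≈/_ to _≡ₚ_; commutativeRing/ to 𝔽ₚ)
  module 𝔽ₚ = CommutativeRing 𝔽ₚ
  open Products 𝔽ₚ.*-commutativeMonoid public
  open Cancellation 𝔽ₚ public
  module 𝔽ₚ-Reasoning = Relation.Binary.Reasoning.Setoid 𝔽ₚ.setoid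

  private instance
    _ = prime⇒nonZero p-prime
    _ = prime⇒nonTrivial p-prime

  1<p : 1 < p
  1<p = ℕ.nonTrivial⇒n>1 p

  ∣⇒≡ₚ : ∀ {x y} → + p ℤD.∣ x ℤ.- y → x ≡ₚ y
  ∣⇒≡ₚ {x} {y} p∣ with ℤS.∣ᵤ⇒∣ p∣
  ... | ℤS.divides h e = h by trans (solveℤ 2 (λ x y → x =ℤ y +ℤ (x -ℤ y)) refl x y) (cong (ℤ._+_ y) e)

  ≡ₚ⇒∣ : ∀ {x y} → x ≡ₚ y → + p ℤD.∣ x ℤ.- y
  ≡ₚ⇒∣ {x} {y} (h by e) = ℤS.∣⇒∣ᵤ (ℤS.divides h
    (trans (cong (ℤ._- y) e) (solveℤ 2 (λ y z → (y +ℤ z) -ℤ y =ℤ z) refl y (h ℤ.* + p))))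

  ∣⇒≡ₚ0 : ∀ {x} → + p ℤD.∣ x → x ≡ₚ + 0
  ∣⇒≡ₚ0 {x} p∣ = ∣⇒≡ₚ (subst (+ p ℤD.∣_) (sym (ℤₚ.+-identityʳ x)) p∣)

  ≡ₚ0⇒∣ : ∀ {x} → x ≡ₚ + 0 → + p ℤD.∣ x
  ≡ₚ0⇒∣ {x} e = subst (+ p ℤD.∣_) (ℤₚ.+-identityʳ x) (≡ₚ⇒∣ e)

  ≢0⇒cancellable : ∀ {x} → ¬ x ≡ₚ + 0 → Cancellable x
  ≢0⇒cancellable {x} x≢0 {y} {z} e with euclidsLemma ∣ x ∣ ∣ y ℤ.- z ∣ p-prime
    (subst (p ∣_) (ℤₚ.abs-* x (y ℤ.- z)) (subst (+ p ℤD.∣_)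
      (solveℤ 3 (λ x y z → x *ℤ y -ℤ x *ℤ z =ℤ x *ℤ (y -ℤ z)) refl x y z) (≡ₚ⇒∣ e)))
  ... | inj₁ p∣x = contradiction (∣⇒≡ₚ0 p∣x) x≢0
  ... | inj₂ p∣y-z = ∣⇒≡ₚ p∣y-z

  *-≢0 : ∀ {x y} → ¬ x ≡ₚ + 0 → ¬ y ≡ₚ + 0 → ¬ x ℤ.* y ≡ₚ + 0
  *-≢0 {x} x≢0 y≢0 e = y≢0 (≢0⇒cancellable x≢0 (𝔽ₚ.trans e (𝔽ₚ.sym (𝔽ₚ.zeroʳ x))))

  ^-cong : ∀ {x y} n → x ≡ₚ y → x ℤ.^ n ≡ₚ y ℤ.^ n
  ^-cong zero    e = 𝔽ₚ.refl
  ^-cong (suc n) e = 𝔽ₚ.*-cong e (^-cong n e)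

  private
    residue-injective-≤ : ∀ {j k} → k ≤ j → j < p → + j ≡ₚ + k → j ≡ k
    residue-injective-≤ {j} {k} k≤j j<p e with j ∸ k in eq | subst (λ z → + p ℤD.∣ z) (sym (+-∸ k≤j)) (≡ₚ⇒∣ e)
    ... | zero  | _  = ℕₚ.≤-antisym (ℕₚ.m∸n≡0⇒m≤n eq) k≤j
    ... | suc d | p∣ = contradiction (ℕₚ.≤-trans (ℕD.∣⇒≤ p∣) (subst (_≤ j) eq (ℕₚ.m∸n≤m j k))) (ℕₚ.<⇒≱ j<p)

  residue-injective : ∀ {j k} → j < p → k < p → + j ≡ₚ + k → j ≡ k
  residue-injective {j} {k} j<p k<p e with ℕₚ.≤-total k j
  ... | inj₁ k≤j = residue-injective-≤ k≤j j<p e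
  ... | inj₂ j≤k = sym (residue-injective-≤ j≤k k<p (𝔽ₚ.sym e))

  units : List ℕ
  units = map suc (upTo (p ∸ 1))

  length-units : length units ≡ p ∸ 1
  length-units = trans (Listₚ.length-map suc (upTo (p ∸ 1))) (Listₚ.length-upTo (p ∸ 1))

  units-unique : Unique units
  units-unique = Uniqueₚ.map⁺ ℕₚ.suc-injective (Uniqueₚ.upTo⁺ (p ∸ 1))

  ∈-units⁺ : ∀ {k} → 1 ≤ k → k < p → k ∈ units
  ∈-units⁺ {suc k} _ k<p = ∈-map⁺ suc (∈-upTo⁺ (ℕₚ.∸-monoˡ-≤ 1 k<p))

  ∈-units⁻ : ∀ {k} → k ∈ units → 1 ≤ k × k < p
  ∈-units⁻ k∈ with ∈-map⁻ suc k∈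
  ... | j , j∈ , refl = s≤s z≤n , 
    subst (_≤ p) (ℕₚ.+-comm (suc j) 1) (ℕₚ.m≤o∸n⇒m+n≤o (suc j) (ℕₚ.<⇒≤ 1<p) (∈-upTo⁻ j∈))

  unit-≢0 : ∀ {k} → k ∈ units → ¬ + k ≡ₚ + 0
  unit-≢0 k∈ e with ∈-units⁻ k∈
  ... | 1≤k , k<p = ℕₚ.>⇒≢ 1≤k (residue-injective k<p (ℕₚ.<-trans (s≤s z≤n) 1<p) e)

  ≡ₚ-%ℕ : ∀ x → x ≡ₚ + (x %ℕ p)
  ≡ₚ-%ℕ x = x /ℕ p by a≡a%ℕn+[a/ℕn]*n x p

  %ℕ-unit : ∀ {x} → ¬ x ≡ₚ + 0 → x %ℕ p ∈ units
  %ℕ-unit {x} x≢0 = ∈-units⁺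
    (ℕₚ.n≢0⇒n>0 λ z → x≢0 (𝔽ₚ.trans (≡ₚ-%ℕ x) (𝔽ₚ.reflexive (cong +_ z)))) (n%ℕd<d x p)

  ∏-const-^ : ∀ {A : Set} x (as : List A) → ∏ (λ _ → x) as ≡ x ℤ.^ length as
  ∏-const-^ x []       = refl
  ∏-const-^ x (a ∷ as) = cong (x ℤ.*_) (∏-const-^ x as)

  -- Multiplication by `x` permutes the units, so it leaves their product unchanged while
  -- contributing one factor `x` for each.
  fermat : ∀ {x} → ¬ x ≡ₚ + 0 → x ℤ.^ (p ∸ 1) ≡ₚ + 1
  fermat {x} x≢0 = ∏-cancellable units (λ k∈ → ≢0⇒cancellable (unit-≢0 k∈)) (begin
    ∏ +_ units ℤ.* x ℤ.^ (p ∸ 1)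
      ≈⟨ 𝔽ₚ.*-comm (∏ +_ units) _ ⟩
    x ℤ.^ (p ∸ 1) ℤ.* ∏ +_ units
      ≡⟨ cong (ℤ._* ∏ +_ units) (trans (∏-const-^ x units) (cong (x ℤ.^_) length-units)) ⟨
    ∏ (λ _ → x) units ℤ.* ∏ +_ units
      ≈⟨ ∏-∙ (λ _ → x) +_ units ⟨
    ∏ (λ k → x ℤ.* + k) units
      ≈⟨ ∏-cong units (λ {k} _ → ≡ₚ-%ℕ (x ℤ.* + k)) ⟩
    ∏ (λ k → + f k) units
      ≡⟨ ∏-map +_ f units ⟨
    ∏ +_ (map f units)
      ≈⟨ ∏-↭ +_ permuted ⟨
    ∏ +_ units
      ≈⟨ 𝔽ₚ.*-identityʳ (∏ +_ units) ⟨
    ∏ +_ units ℤ.* + 1 ∎)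
    where
    open 𝔽ₚ-Reasoning
    f : ℕ → ℕ
    f k = (x ℤ.* + k) %ℕ p
    f-injective : ∀ {j k} → j ∈ units → k ∈ units → f j ≡ f k → j ≡ k
    f-injective {j} {k} j∈ k∈ e = residue-injective (proj₂ (∈-units⁻ j∈)) (proj₂ (∈-units⁻ k∈))
      (≢0⇒cancellable x≢0 (𝔽ₚ.trans (≡ₚ-%ℕ (x ℤ.* + j))
        (𝔽ₚ.trans (𝔽ₚ.reflexive (cong +_ e)) (𝔽ₚ.sym (≡ₚ-%ℕ (x ℤ.* + k))))))
    f-⊆ : map f units ⊆ units
    f-⊆ y∈ with ∈-map⁻ f y∈
    ... | k , k∈ , refl = %ℕ-unit (*-≢0 x≢0 (unit-≢0 k∈))
    permuted : units ↭ map f units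
    permuted = unique-⊆-length⇒↭ (unique-map units f-injective units-unique) f-⊆
      (ℕₚ.≤-reflexive (sym (Listₚ.length-map f units)))

  -- Lagrange's bound: after division by x - r the other roots remain roots, because a difference of
  -- distinct residues can be cancelled.
  length-roots : ∀ f rs → Unique rs → rs ⊆ units → (∀ {r} → r ∈ rs → evalMonic f (+ r) ≡ₚ + 0) →
                 length rs ≤ length f
  length-roots f       []       _        _   _    = z≤n
  -- The empty list is the constant 1; a root would make `p` divide 1.
  length-roots []      (r ∷ rs) _        _   root =
    contradiction (ℕD.∣⇒≤ (≡ₚ0⇒∣ (root (here refl)))) (ℕₚ.<⇒≱ 1<p)
  length-roots (c ∷ f) (r ∷ rs) (r∉ ∷ u) rs⊆ root =
    s≤s (subst (length rs ≤_) (length-deflate (+ r) c f)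
      (length-roots (deflate (+ r) (c ∷ f)) rs u (λ x∈ → rs⊆ (there x∈)) root′))
    where
    root′ : ∀ {x} → x ∈ rs → evalMonic (deflate (+ r) (c ∷ f)) (+ x) ≡ₚ + 0
    root′ {x} x∈ = ≢0⇒cancellable x-r≢0 (begin
      (+ x ℤ.- + r) ℤ.* evalMonic (deflate (+ r) (c ∷ f)) (+ x)
        ≈⟨ 𝔽ₚ.+-identityˡ _ ⟨
      + 0 ℤ.+ (+ x ℤ.- + r) ℤ.* evalMonic (deflate (+ r) (c ∷ f)) (+ x)
        ≈⟨ 𝔽ₚ.+-congʳ (root (here refl)) ⟨
      evalMonic (c ∷ f) (+ r) ℤ.+ (+ x ℤ.- + r) ℤ.* evalMonic (deflate (+ r) (c ∷ f)) (+ x)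
        ≡⟨ evalMonic-deflate (+ r) c f (+ x) ⟨
      evalMonic (c ∷ f) (+ x)
        ≈⟨ root (there x∈) ⟩
      + 0
        ≈⟨ 𝔽ₚ.zeroʳ (+ x ℤ.- + r) ⟨
      (+ x ℤ.- + r) ℤ.* + 0 ∎)
      where
      open 𝔽ₚ-Reasoning
      x-r≢0 : ¬ + x ℤ.- + r ≡ₚ + 0
      x-r≢0 e = All.lookup r∉ x∈ (sym (residue-injective
        (proj₂ (∈-units⁻ (rs⊆ (there x∈)))) (proj₂ (∈-units⁻ (rs⊆ (here refl)))) (∣⇒≡ₚ (≡ₚ0⇒∣ e))))

  length-power-roots : ∀ n (c : ℤ) rs → 1 ≤ n → Unique rs → rs ⊆ units →
                       (∀ {r} → r ∈ rs → (+ r) ℤ.^ n ≡ₚ c) → length rs ≤ n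
  length-power-roots (suc n) c rs _ u rs⊆ root = subst (length rs ≤_) (cong suc (Listₚ.length-replicate n))
    (length-roots (ℤ.- c ∷ replicate n (+ 0)) rs u rs⊆ λ {r} r∈ → begin
      evalMonic (ℤ.- c ∷ replicate n (+ 0)) (+ r)  ≡⟨ evalMonic-binomial c n (+ r) ⟩
      (+ r) ℤ.^ suc n ℤ.- c                          ≈⟨ 𝔽ₚ.+-congʳ (root r∈) ⟩
      c ℤ.- c                                      ≈⟨ 𝔽ₚ.-‿inverseʳ c ⟩
      + 0                                          ∎)
    where open 𝔽ₚ-Reasoning

-- Power residues

concatMap-length : ∀ {A B : Set} {f : A → List B} {n} xs → (∀ {x} → x ∈ xs → length (f x) ≤ n) →
                   length (concatMap f xs) ≤ length xs * n
concatMap-length         []       b = z≤n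
concatMap-length {f = f} (x ∷ xs) b rewrite Listₚ.length-++ (f x) {concatMap f xs} =
  ℕₚ.+-mono-≤ (b (here refl)) (concatMap-length xs (λ x∈ → b (there x∈)))

module Power-residues {m p q : ℕ} (1≤m : 1 ≤ m) (p-prime : Prime p) (p∸1≡ : p ∸ 1 ≡ q * (2 * m)) where

  open Prime-field p-prime

  private
    residue? = λ k → Any.any? (λ x → p ℕD.∣? ∣ (+ x) ℤ.^ m ℤ.- + k ∣) (upTo p)
    instance _ = prime⇒nonZero p-prime

  p≡ : p ≡ suc (2 * (q * m))
  p≡ = begin-equality
    p                    ≡⟨ ℕₚ.m+[n∸m]≡n (ℕₚ.<⇒≤ 1<p) ⟨
    suc (p ∸ 1)          ≡⟨ cong suc p∸1≡ ⟩
    suc (q * (2 * m))    ≡⟨ cong suc (trans (sym (ℕₚ.*-assoc q 2 m)) (trans (cong (_* m) (ℕₚ.*-comm q 2)) (ℕₚ.*-assoc 2 q m))) ⟩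
    suc (2 * (q * m))    ∎
    where open ℕₚ.≤-Reasoning

  p-odd : ∀ k → 2 * k ≢ p
  p-odd k e = ℕₚ.even≢odd k (q * m) (trans e p≡)

  1≤2q : 1 ≤ 2 * q
  1≤2q = ℕₚ.n≢0⇒n>0 λ z → ℕₚ.<⇒≢ 1<p (sym (trans p≡ (cong suc (begin-equality
    2 * (q * m)  ≡⟨ ℕₚ.*-assoc 2 q m ⟨
    2 * q * m    ≡⟨ cong (_* m) z ⟩
    0            ∎))))
    where open ℕₚ.≤-Reasoning

  R⁻ : ∀ {k} → k ∈ R m p → k ∈ units × ∃[ x ] x ℤ.^ m ≡ₚ + k
  R⁻ k∈ with ∈-filter⁻ residue? {xs = units} k∈
  ... | k∈units , any = k∈units , let x , p∣ = Any.satisfied any in + x , ∣⇒≡ₚ p∣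

  R⁺ : ∀ {k} → k ∈ units → ∀ {x} → x ℤ.^ m ≡ₚ + k → k ∈ R m p
  R⁺ k∈ {x} e = ∈-filter⁺ residue? k∈ (lose (∈-upTo⁺ (n%ℕd<d x p))
    (≡ₚ⇒∣ (𝔽ₚ.trans (^-cong m (𝔽ₚ.sym (≡ₚ-%ℕ x))) e)))

  R-unique : Unique (R m p)
  R-unique = Uniqueₚ.filter⁺ residue? units-unique

  power^2q : ∀ {x} → ¬ x ≡ₚ + 0 → (x ℤ.^ m) ℤ.^ (2 * q) ≡ₚ + 1
  power^2q {x} x≢0 = begin
    (x ℤ.^ m) ℤ.^ (2 * q)  ≡⟨ ℤₚ.^-*-assoc x m (2 * q) ⟩
    x ℤ.^ (m * (2 * q))    ≡⟨ cong (x ℤ.^_) exponent ⟩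
    x ℤ.^ (p ∸ 1)          ≈⟨ fermat x≢0 ⟩
    + 1                    ∎
    where
    open 𝔽ₚ-Reasoning
    exponent : m * (2 * q) ≡ p ∸ 1
    exponent = trans (ℕₚ.*-comm m (2 * q)) (trans (cong (_* m) (ℕₚ.*-comm 2 q)) (trans (ℕₚ.*-assoc q 2 m) (sym p∸1≡)))

  power≢0⇒base≢0 : ∀ {x y} → x ℤ.^ m ≡ₚ y → ¬ y ≡ₚ + 0 → ¬ x ≡ₚ + 0
  power≢0⇒base≢0 e y≢0 x≡0 = y≢0 (𝔽ₚ.trans (𝔽ₚ.sym e) (𝔽ₚ.trans (^-cong m x≡0) (0^ m 1≤m)))
    where
    0^ : ∀ m → 1 ≤ m → (+ 0) ℤ.^ m ≡ₚ + 0
    0^ (suc m) _ = 𝔽ₚ.zeroˡ ((+ 0) ℤ.^ m)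

  R^2q : ∀ {k} → k ∈ R m p → (+ k) ℤ.^ (2 * q) ≡ₚ + 1
  R^2q k∈ with R⁻ k∈
  ... | k∈units , x , e = 𝔽ₚ.trans (^-cong (2 * q) (𝔽ₚ.sym e))
                            (power^2q (power≢0⇒base≢0 e (unit-≢0 k∈units)))

  2^2q : IsPowerResidue m p (+ 2) → (+ 2) ℤ.^ (2 * q) ≡ₚ + 1
  2^2q (x , p∣) = 𝔽ₚ.trans (^-cong (2 * q) (𝔽ₚ.sym e)) (power^2q (power≢0⇒base≢0 e 2≢0))
    where
    e : x ℤ.^ m ≡ₚ + 2
    e = ∣⇒≡ₚ p∣
    2≢0 : ¬ + 2 ≡ₚ + 0
    2≢0 z = p-odd 1 (ℕₚ.≤-antisym 1<p (ℕD.∣⇒≤ (≡ₚ0⇒∣ z)))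

  private
    fibre : ℕ → List ℕ
    fibre k = filter (λ x → p ℕD.∣? ∣ (+ x) ℤ.^ m ℤ.- + k ∣) units

    fibre-length : ∀ k → length (fibre k) ≤ m
    fibre-length k = length-power-roots m (+ k) (fibre k) 1≤m
      (Uniqueₚ.filter⁺ _ units-unique)
      (λ x∈ → proj₁ (∈-filter⁻ (λ x → p ℕD.∣? ∣ (+ x) ℤ.^ m ℤ.- + k ∣) {xs = units} x∈))
      (λ x∈ → ∣⇒≡ₚ (proj₂ (∈-filter⁻ (λ x → p ℕD.∣? ∣ (+ x) ℤ.^ m ℤ.- + k ∣) {xs = units} x∈)))

    fibres-cover : units ⊆ concatMap fibre (R m p)
    fibres-cover {x} x∈ = ∈-concatMap⁺ fibre (lose {P = λ k → x ∈ fibre k} (R⁺ k∈ e)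
      (∈-filter⁺ (λ x → p ℕD.∣? ∣ (+ x) ℤ.^ m ℤ.- + k ∣) x∈ (≡ₚ⇒∣ e)))
      where
      k = ((+ x) ℤ.^ m) %ℕ p
      e : (+ x) ℤ.^ m ≡ₚ + k
      e = ≡ₚ-%ℕ ((+ x) ℤ.^ m)
      ^-≢0 : ∀ n → ¬ (+ x) ℤ.^ n ≡ₚ + 0
      ^-≢0 zero    = unit-≢0 (∈-units⁺ {1} (s≤s z≤n) 1<p)
      ^-≢0 (suc n) = *-≢0 (unit-≢0 x∈) (^-≢0 n)
      k∈ : k ∈ units
      k∈ = %ℕ-unit (^-≢0 m)

  -- Counting stands in for a primitive root. All elements are roots of x^(2q) - 1, which bounds
  -- their number above; the m-th power map sends the 2qm units into `R m p` with fibres of at most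
  -- `m` elements, which bounds it below.
  length-R : length (R m p) ≡ 2 * q
  length-R = ℕₚ.≤-antisym
    (length-power-roots (2 * q) (+ 1) (R m p) 1≤2q R-unique (λ k∈ → proj₁ (R⁻ k∈)) R^2q)
    (ℕₚ.*-cancelʳ-≤ (2 * q) (length (R m p)) m {{ℕ.>-nonZero 1≤m}} (begin
      2 * q * m                        ≡⟨ trans (cong (_* m) (ℕₚ.*-comm 2 q)) (trans (ℕₚ.*-assoc q 2 m) (sym p∸1≡)) ⟩
      p ∸ 1                            ≡⟨ length-units ⟨
      length units                     ≤⟨ unique-⊆⇒length≤ units-unique fibres-cover ⟩
      length (concatMap fibre (R m p)) ≤⟨ concatMap-length (R m p) (λ {k} _ → fibre-length k) ⟩
      length (R m p) * m               ∎))
    where open ℕₚ.≤-Reasoning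

  -- Euler's criterion: the residues already exhaust the 2q roots that x^(2q) - 1 can have. Closure
  -- under negation and doubling is checked through this exponent.
  ^2q⇒R : ∀ {k} → k ∈ units → (+ k) ℤ.^ (2 * q) ≡ₚ + 1 → k ∈ R m p
  ^2q⇒R {k} k∈ e with k ∈? R m p
  ... | yes k∈R = k∈R
  ... | no k∉R  = contradiction
    (subst (λ n → suc n ≤ 2 * q) length-R
      (length-power-roots (2 * q) (+ 1) (k ∷ R m p) 1≤2q
        (All.tabulate (λ j∈ k≡j → k∉R (subst (_∈ R m p) (sym k≡j) j∈)) ∷ R-unique)
        (λ { (here refl) → k∈ ; (there j∈) → proj₁ (R⁻ j∈) })
        (λ { (here refl) → e  ; (there j∈) → R^2q j∈ })))
    (ℕₚ.<⇒≱ (ℕₚ.n<1+n (2 * q)))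

  p∸-<2p : ∀ {k} → k ≤ p → ¬ 2 * k < p → 2 * (p ∸ k) < p
  p∸-<2p {k} k≤p 2k≮p = ℕₚ.+-cancelʳ-< (2 * k) (2 * (p ∸ k)) p (begin
    suc (2 * (p ∸ k) + 2 * k)  ≡⟨ cong suc (ℕₚ.*-distribˡ-+ 2 (p ∸ k) k) ⟨
    suc (2 * (p ∸ k + k))      ≡⟨ cong (λ n → suc (2 * n)) (ℕₚ.m∸n+n≡m k≤p) ⟩
    suc (2 * p)                ≡⟨ cong (λ n → suc (p + n)) (ℕₚ.+-identityʳ p) ⟩
    suc (p + p)                ≡⟨ ℕₚ.+-suc p p ⟨
    -- Oddness of `p` excludes equality in p ≤ 2k.
    p + suc p                  ≤⟨ ℕₚ.+-monoʳ-≤ p (ℕₚ.≤∧≢⇒< (ℕₚ.≮⇒≥ 2k≮p) (≢-sym (p-odd k))) ⟩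
    p + 2 * k                  ∎)
    where open ℕₚ.≤-Reasoning

  -- The exponent 2q is even, so -k satisfies Euler's criterion whenever k does.
  R-reflect : ∀ {k} → k ∈ R m p → p ∸ k ∈ R m p
  R-reflect {k} k∈ with R⁻ k∈
  ... | k∈units , _ with ∈-units⁻ k∈units
  ...   | 1≤k , k<p = ^2q⇒R (∈-units⁺ (ℕₚ.m<n⇒0<n∸m k<p) (ℕₚ.∸-monoʳ-< {p} 1≤k (ℕₚ.<⇒≤ k<p))) (begin
    (+ (p ∸ k)) ℤ.^ (2 * q)          ≡⟨ cong (ℤ._^ (2 * q)) (+-∸ (ℕₚ.<⇒≤ k<p)) ⟩
    (+ p ℤ.- + k) ℤ.^ (2 * q)        ≈⟨ ^-cong (2 * q) (+ 1 by solveℤ 2 (λ p k → p -ℤ k =ℤ -ℤ k +ℤ conℤ (+ 1) *ℤ p) refl (+ p) (+ k)) ⟩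
    (ℤ.- + k) ℤ.^ (2 * q)            ≡⟨ ℤₚ.^-*-assoc (ℤ.- + k) 2 q ⟨
    ((ℤ.- + k) ℤ.^ 2) ℤ.^ q          ≡⟨ cong (ℤ._^ q) (solveℤ 1 (λ k → -ℤ k *ℤ (-ℤ k *ℤ conℤ (+ 1)) =ℤ k *ℤ (k *ℤ conℤ (+ 1))) refl (+ k)) ⟩
    ((+ k) ℤ.^ 2) ℤ.^ q              ≡⟨ ℤₚ.^-*-assoc (+ k) 2 q ⟩
    (+ k) ℤ.^ (2 * q)                ≈⟨ R^2q k∈ ⟩
    + 1                              ∎)
    where open 𝔽ₚ-Reasoning

  half : List ℕ
  half = filter (λ k → 2 * k <? p) (R m p)

  half⁻ : ∀ {k} → k ∈ half → k ∈ R m p × 2 * k < p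
  half⁻ = ∈-filter⁻ (λ k → 2 * k <? p) {xs = R m p}

  half⁺ : ∀ {k} → k ∈ R m p → 2 * k < p → k ∈ half
  half⁺ = ∈-filter⁺ (λ k → 2 * k <? p)

  half-positive : ∀ {k} → k ∈ half → 1 ≤ k
  half-positive k∈ = proj₁ (∈-units⁻ (proj₁ (R⁻ (proj₁ (half⁻ k∈)))))

  half-< : ∀ {k} → k ∈ half → k < p
  half-< k∈ = proj₂ (∈-units⁻ (proj₁ (R⁻ (proj₁ (half⁻ k∈)))))

  half-unique : Unique half
  half-unique = Uniqueₚ.filter⁺ (λ k → 2 * k <? p) R-unique

  R-↭ : R m p ↭ half ++ map (p ∸_) half
  R-↭ = unique-⊆⊇⇒↭ R-unique
    (Uniqueₚ.++⁺ half-unique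
      (unique-map half (λ j∈ k∈ → ℕₚ.∸-cancelˡ-≡ (ℕₚ.<⇒≤ (half-< j∈)) (ℕₚ.<⇒≤ (half-< k∈))) half-unique)
      disjoint)
    (λ k∈ → [ (λ k∈ → proj₁ (half⁻ k∈)) , reflected ]′ (∈-++⁻ half k∈))
    cover
    where
    open ℕₚ.≤-Reasoning
    disjoint : ∀ {k} → ¬ (k ∈ half × k ∈ map (p ∸_) half)
    disjoint (k∈ , k∈′) with ∈-map⁻ (p ∸_) k∈′
    -- Both `j` and `p ∸ j` would lie below p/2, although their sum is `p`.
    ... | j , j∈ , refl = ℕₚ.<-irrefl refl (begin-strict
      2 * p                  ≡⟨ cong (2 *_) (ℕₚ.m∸n+n≡m (ℕₚ.<⇒≤ (half-< j∈))) ⟨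
      2 * (p ∸ j + j)        ≡⟨ ℕₚ.*-distribˡ-+ 2 (p ∸ j) j ⟩
      2 * (p ∸ j) + 2 * j    <⟨ ℕₚ.+-mono-< (proj₂ (half⁻ k∈)) (proj₂ (half⁻ j∈)) ⟩
      p + p                  ≡⟨ cong (ℕ._+_ p) (ℕₚ.+-identityʳ p) ⟨
      2 * p                  ∎)
    reflected : ∀ {k} → k ∈ map (p ∸_) half → k ∈ R m p
    reflected k∈ with ∈-map⁻ (p ∸_) k∈
    ... | j , j∈ , refl = R-reflect (proj₁ (half⁻ j∈))
    cover : R m p ⊆ half ++ map (p ∸_) half
    cover {k} k∈ with 2 * k <? p
    ... | yes 2k<p = ∈-++⁺ˡ (half⁺ k∈ 2k<p)
    ... | no 2k≮p  = ∈-++⁺ʳ half (subst (_∈ map (p ∸_) half) (ℕₚ.m∸[m∸n]≡n k≤p)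
                       (∈-map⁺ (p ∸_) (half⁺ (R-reflect k∈) (p∸-<2p k≤p 2k≮p))))
      where k≤p = ℕₚ.<⇒≤ (proj₂ (∈-units⁻ (proj₁ (R⁻ k∈))))

  length-half : length half ≡ q
  length-half = ℕₚ.*-cancelˡ-≡ (length half) q 2 (begin-equality
    2 * length half                              ≡⟨ cong (ℕ._+_ (length half)) (ℕₚ.+-identityʳ (length half)) ⟩
    length half + length half                    ≡⟨ cong (ℕ._+_ (length half)) (Listₚ.length-map (p ∸_) half) ⟨
    length half + length (map (p ∸_) half)       ≡⟨ Listₚ.length-++ half ⟨
    length (half ++ map (p ∸_) half)             ≡⟨ ↭ₚ.↭-length R-↭ ⟨
    length (R m p)                               ≡⟨ length-R ⟩
    2 * q                                        ∎)
    where open ℕₚ.≤-Reasoning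

  open Gauss p half public

  module _ (2-residue : IsPowerResidue m p (+ 2)) where

    private
      double-R : ∀ {h} → h ∈ half → 2 * h ∈ R m p
      double-R {h} h∈ = ^2q⇒R
        (∈-units⁺ (ℕₚ.≤-trans (half-positive h∈) (ℕₚ.m≤n*m h 2)) (proj₂ (half⁻ h∈))) (begin
        (+ (2 * h)) ℤ.^ (2 * q)                  ≡⟨ cong (ℤ._^ (2 * q)) (ℤₚ.pos-* 2 h) ⟩
        (+ 2 ℤ.* + h) ℤ.^ (2 * q)                ≡⟨ *-^-distrib (+ 2) (+ h) (2 * q) ⟩
        (+ 2) ℤ.^ (2 * q) ℤ.* (+ h) ℤ.^ (2 * q)  ≈⟨ 𝔽ₚ.*-cong (2^2q 2-residue) (R^2q (proj₁ (half⁻ h∈))) ⟩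
        + 1                                      ∎)
        where open 𝔽ₚ-Reasoning

      fold-half : ∀ {h} → h ∈ half → fold h ∈ half
      fold-half {h} h∈ with 2 * (2 * h) <? p
      ... | yes 4h<p = half⁺ (double-R h∈) 4h<p
      ... | no 4h≮p  = half⁺ (R-reflect (double-R h∈)) (p∸-<2p (ℕₚ.<⇒≤ (proj₂ (half⁻ h∈))) 4h≮p)

      -- Equality would make `p` even. Thus a doubled element that stays in place never meets a
      -- reflected one.
      collision : ∀ {h k} → 2 * k < p → 2 * h ≢ p ∸ 2 * k
      collision {h} {k} 2k<p e = p-odd (h + k) (trans (ℕₚ.*-distribˡ-+ 2 h k)
        (trans (cong (_+ 2 * k) e) (ℕₚ.m∸n+n≡m (ℕₚ.<⇒≤ 2k<p))))

      fold-injective : ∀ {h k} → h ∈ half → k ∈ half → fold h ≡ fold k → h ≡ k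
      fold-injective {h} {k} h∈ k∈ e with 2 * (2 * h) <? p | 2 * (2 * k) <? p
      ... | yes _ | yes _ = ℕₚ.*-cancelˡ-≡ h k 2 e
      ... | yes _ | no _  = contradiction e (collision {h} {k} (proj₂ (half⁻ k∈)))
      ... | no _  | yes _ = contradiction (sym e) (collision {k} {h} (proj₂ (half⁻ h∈)))
      ... | no _  | no _  = ℕₚ.*-cancelˡ-≡ h k 2
        (ℕₚ.∸-cancelˡ-≡ (ℕₚ.<⇒≤ (proj₂ (half⁻ h∈))) (ℕₚ.<⇒≤ (proj₂ (half⁻ k∈))) e)

    fold-↭ : map fold half ↭ half
    fold-↭ = ↭-sym (unique-⊆-length⇒↭ (unique-map half fold-injective half-unique)
      (λ k∈ → let h , h∈ , e = ∈-map⁻ fold k∈ in subst (_∈ half) (sym e) (fold-half h∈))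
      (ℕₚ.≤-reflexive (sym (Listₚ.length-map fold half))))

    2^q : (+ 2) ℤ.^ q ≡ₚ (ℤ.- + 1) ℤ.^ flips
    2^q = begin
      (+ 2) ℤ.^ q           ≡⟨ cong ((+ 2) ℤ.^_) length-half ⟨
      (+ 2) ℤ.^ length half ≡⟨ ∏-const-^ (+ 2) half ⟨
      ∏ (λ _ → + 2) half    ≈⟨ gauss 𝔽ₚ +_ (λ _ → + 2) fold-↭
                                 (λ {h} _ → 𝔽ₚ.reflexive (ℤₚ.pos-* 2 h))
                                 (λ {h} h∈ → + 1 by trans (+-∸ (ℕₚ.<⇒≤ (proj₂ (half⁻ h∈))))
                                   (solveℤ 2 (λ p k → p -ℤ k =ℤ -ℤ k +ℤ conℤ (+ 1) *ℤ p) refl (+ p) (+ (2 * h))))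
                                 (λ h∈ → ≢0⇒cancellable (unit-≢0 (proj₁ (R⁻ (proj₁ (half⁻ h∈)))))) ⟩
      _                     ≡⟨ power flips ⟩
      (ℤ.- + 1) ℤ.^ flips   ∎
      where
      open 𝔽ₚ-Reasoning
      open Exponentiation 𝔽ₚ.semiring using (_^_)
      power : ∀ n → (ℤ.- + 1) ^ n ≡ (ℤ.- + 1) ℤ.^ n
      power zero    = refl
      power (suc n) = cong (ℤ._*_ (ℤ.- + 1)) (power n)

-- The quotient of ℤ[x] by a monic polynomial

m<n^m : ∀ {n} → 1 < n → ∀ m → m < n ℕ.^ m
m<n^m {n} 1<n zero    = s≤s z≤n
m<n^m {n} 1<n (suc m) = begin-strict
  suc m            ≤⟨ m<n^m 1<n m ⟩
  n ℕ.^ m            <⟨ ℕₚ.m<m*n (n ℕ.^ m) n {{ℕ.>-nonZero (ℕₚ.≤-<-trans z≤n (m<n^m 1<n m))}} 1<n ⟩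
  n ℕ.^ m * n        ≡⟨ ℕₚ.*-comm (n ℕ.^ m) n ⟩
  n ℕ.^ suc m        ∎
  where open ℕₚ.≤-Reasoning

module Monic-quotient {G : Poly} {degree : ℕ} (M : Monic G degree) where

  open Quotient polyRing G public
    using (_by_; lift) renaming (_≈/_ to _≈ᴳ_; commutativeRing/ to ℤ[x]/G)
  module ℤ[x]/G = CommutativeRing ℤ[x]/G
  open CommutativeExp ℤ[x]/G.commutativeSemiring public
    using ()
    renaming (_^_ to _^ᴳ_; ^-homo-* to ^ᴳ-homo-*; ^-assocʳ to ^ᴳ-assocʳ; ^-congˡ to ^ᴳ-congˡ; ^-distrib-* to ^ᴳ-distrib-*)
  module ℤ[x]/G-Reasoning = Relation.Binary.Reasoning.Setoid ℤ[x]/G.setoid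

  ^P≡^ᴳ : ∀ f n → f ^P n ≡ f ^ᴳ n
  ^P≡^ᴳ f zero    = refl
  ^P≡^ᴳ f (suc n) = cong (f ⊗_) (^P≡^ᴳ f n)

  1^ᴳ : ∀ n → oneP ^ᴳ n ≈ᴳ oneP
  1^ᴳ zero    = ℤ[x]/G.refl
  1^ᴳ (suc n) = ℤ[x]/G.trans (ℤ[x]/G.*-identityˡ (oneP ^ᴳ n)) (1^ᴳ n)

  const-^ᴳ : ∀ c n → const (c ℤ.^ n) ≈ᴳ const c ^ᴳ n
  const-^ᴳ c zero    = ℤ[x]/G.refl
  const-^ᴳ c (suc n) = ℤ[x]/G.trans (lift (const-* c (c ℤ.^ n))) (ℤ[x]/G.*-congˡ {const c} (const-^ᴳ c n))

  ≈ᴳ0-difference : ∀ {f g} → f ⊖ g ≈ᴳ [] → f ≈ᴳ g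
  ≈ᴳ0-difference {f} {g} e = ℤ[x]/G.trans (lift (solve 2 (λ f g → f := (f :- g) :+ g) ≋-refl f g)) (ℤ[x]/G.+-congʳ {g} e)

  difference-≈ᴳ0 : ∀ {f g} → f ≈ᴳ g → f ⊖ g ≈ᴳ []
  difference-≈ᴳ0 {f} {g} e = ℤ[x]/G.trans (ℤ[x]/G.+-congʳ {negP g} e) (ℤ[x]/G.-‿inverseʳ g)

  ∣⇒≈ᴳ0 : ∀ {f} → G ∣ᴾ f → f ≈ᴳ []
  ∣⇒≈ᴳ0 (h , e) = h by ≋-sym e

  ≈ᴳ0⇒∣ : ∀ {f} → f ≈ᴳ [] → G ∣ᴾ f
  ≈ᴳ0⇒∣ (h by e) = h , ≋-sym e

  torsion-free : ∀ {c f} → c ≢ + 0 → const c ⊗ f ≈ᴳ [] → f ≈ᴳ []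
  torsion-free {c} {f} c≢0 e = ∣⇒≈ᴳ0 {f} (scale-multiple⇒multiple {c} {f} c≢0 M (≈ᴳ0⇒∣ {const c ⊗ f} e))

  -- Every coefficient of the reduced representative is divisible by p^k for all k, so it vanishes.
  p-adically-separated : ∀ {p f} → 1 < p → (∀ k → ∃[ w ] f ≈ᴳ const (+ (p ℕ.^ k)) ⊗ w) → f ≈ᴳ []
  p-adically-separated {p} {f} 1<p divisible with remainder f M
  ... | q , r , f≋ , b = q by (≋-trans f≋ (≋-trans (⊕-congˡ (q ⊗ G) (mk≋ vanish)) (⊕-comm (q ⊗ G) [])))
    where
    vanish : ∀ j → coeff r j ≡ + 0
    -- The exponent is the size of the coefficient itself: p^n exceeds n, so only 0 is divisible by
    -- that power.
    vanish j with divisible ∣ coeff r j ∣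
    ... | w , (h by e) with remainder w M
    ...   | q′ , r′ , w≋ , b′ = ℤₚ.∣i∣≡0⇒i≡0 (zero-multiple (coeff r j) (coeff r′ j) coeff-r)
      where
      c = + (p ℕ.^ ∣ coeff r j ∣)
      -- Both `r` and `c r′` are reduced representatives of `f`; once their difference is a multiple
      -- of `G`, it is zero.
      r-cr′ : r ⊖ const c ⊗ r′ ≋ (const c ⊗ q′ ⊕ h ⊖ q) ⊗ G
      r-cr′ = begin
        r ⊖ const c ⊗ r′
          ≈⟨ solve 3 (λ r x y → r :- x := (y :+ r) :- y :- x) ≋-refl r (const c ⊗ r′) (q ⊗ G) ⟩
        (q ⊗ G ⊕ r) ⊖ q ⊗ G ⊖ const c ⊗ r′
          ≈⟨ ⊕-congʳ (negP (const c ⊗ r′)) (⊕-congʳ (negP (q ⊗ G)) (≋-trans (≋-sym f≋)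
               (≋-trans e (⊕-congʳ (h ⊗ G) (≋-trans (⊗-congˡ (const c) w≋)
                 (solve 4 (λ c q f r → c :* (q :* f :+ r) := c :* q :* f :+ c :* r) ≋-refl (const c) q′ (G) r′)))))) ⟩
        ((const c ⊗ q′ ⊗ G ⊕ const c ⊗ r′) ⊕ h ⊗ G) ⊖ q ⊗ G ⊖ const c ⊗ r′
          ≈⟨ solve 5 (λ x y q h f → ((y :* f :+ x) :+ h :* f) :- q :* f :- x := (y :+ h :- q) :* f)
               ≋-refl (const c ⊗ r′) (const c ⊗ q′) q h (G) ⟩
        (const c ⊗ q′ ⊕ h ⊖ q) ⊗ G ∎
        where open ≋-Reasoning
      short : DegLt (r ⊖ const c ⊗ r′) degree
      short = degLt-⊕ {r} {negP (const c ⊗ r′)} b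
        (degLt-negP {const c ⊗ r′} (degLt-cong (≋-sym (const-⊗ c r′)) (degLt-scale c {r′} b′)))
      r≋cr′ : r ≋ scale c r′
      r≋cr′ = begin
        r                                     ≈⟨ solve 2 (λ r s → r := (r :- s) :+ s) ≋-refl r (const c ⊗ r′) ⟩
        (r ⊖ const c ⊗ r′) ⊕ const c ⊗ r′     ≈⟨ ⊕-congʳ (const c ⊗ r′) (multiple⇒remainder≋[] (const c ⊗ q′ ⊕ h ⊖ q) [] M r-cr′ ≋-refl short) ⟩
        const c ⊗ r′                          ≈⟨ const-⊗ c r′ ⟩
        scale c r′                            ∎
        where open ≋-Reasoning
      coeff-r : coeff r j ≡ c ℤ.* coeff r′ j
      coeff-r = trans (at r≋cr′ j) (coeff-scale c r′ j)
      zero-multiple : ∀ x y → x ≡ + (p ℕ.^ ∣ x ∣) ℤ.* y → ∣ x ∣ ≡ 0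
      zero-multiple x y e with ∣ x ∣ in eq
      ... | zero  = refl
      ... | suc n = contradiction
        (ℕD.∣⇒≤ (divides ∣ y ∣ (trans (sym eq) (trans (cong ∣_∣ e) (trans (ℤₚ.abs-* (+ (p ℕ.^ suc n)) y) (ℕₚ.*-comm (p ℕ.^ suc n) ∣ y ∣))))))
        (ℕₚ.<⇒≱ (m<n^m 1<p (suc n)))

  p-multiple⇒0 : ∀ {p f} c → 1 < p → f ≈ᴳ const (+ p) ⊗ c ⊗ f → f ≈ᴳ []
  p-multiple⇒0 {p} {f} c 1<p e = p-adically-separated 1<p divisible
    where
    divisible : ∀ k → ∃[ w ] f ≈ᴳ const (+ (p ℕ.^ k)) ⊗ w
    divisible zero = f , lift (≋-sym (⊗-identityˡ f))
    divisible (suc k) with divisible k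
    ... | w , e′ = c ⊗ w , (begin
      f                                              ≈⟨ e ⟩
      const (+ p) ⊗ c ⊗ f                            ≈⟨ ℤ[x]/G.*-congˡ {const (+ p) ⊗ c} e′ ⟩
      const (+ p) ⊗ c ⊗ (const (+ (p ℕ.^ k)) ⊗ w)      ≈⟨ lift (solve 4 (λ p c p′ w → p :* c :* (p′ :* w) := p :* p′ :* (c :* w)) ≋-refl (const (+ p)) c (const (+ (p ℕ.^ k))) w) ⟩
      const (+ p) ⊗ const (+ (p ℕ.^ k)) ⊗ (c ⊗ w)      ≈⟨ ℤ[x]/G.*-congʳ {c ⊗ w} (lift (const-* (+ p) (+ (p ℕ.^ k)))) ⟨
      const (+ p ℤ.* + (p ℕ.^ k)) ⊗ (c ⊗ w)            ≡⟨ cong (λ x → const x ⊗ (c ⊗ w)) (ℤₚ.pos-* p (p ℕ.^ k)) ⟨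
      const (+ (p ℕ.^ suc k)) ⊗ (c ⊗ w)                ∎)
      where open ℤ[x]/G-Reasoning

  -- y^n − 1 = (y − 1)(n + t(y − 1)) vanishes, so inverting n modulo p exhibits y − 1 as a multiple of p (y − 1).
  root-of-unity≡1 : ∀ {p n y} u h c → 1 < p → u ℤ.* + n ≡ + 1 ℤ.+ h ℤ.* + p →
                    y ^ᴳ n ≈ᴳ oneP → y ⊖ oneP ≈ᴳ const (+ p) ⊗ c → y ≈ᴳ oneP
  root-of-unity≡1 {p} {n} {y} u h c 1<p un≡ y^n y-1 with geom-const y n
  ... | t , t≋ = ≈ᴳ0-difference (p-multiple⇒0 (negP (const h ⊕ const u ⊗ t ⊗ c)) 1<p (begin
    d
      ≈⟨ lift (solve 3 (λ d h p → d := (con (+ 1) :+ h :* p) :* d :- h :* p :* d) ≋-refl d (const h) (const (+ p))) ⟩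
    (oneP ⊕ const h ⊗ const (+ p)) ⊗ d ⊖ const h ⊗ const (+ p) ⊗ d
      ≈⟨ ℤ[x]/G.+-congʳ {negP (const h ⊗ const (+ p) ⊗ d)} (ℤ[x]/G.*-congʳ {d} (lift un≋)) ⟨
    const u ⊗ const (+ n) ⊗ d ⊖ const h ⊗ const (+ p) ⊗ d
      -- Here n d becomes (n + t d) d - t d d. The first term is y^n - 1 = 0, and one factor `d` of
      -- the second is then replaced by p c.
      ≈⟨ lift (⊕-congʳ (negP (const h ⊗ const (+ p) ⊗ d)) (solve 4 (λ u n d t → u :* n :* d
           := u :* ((n :+ t :* d) :* d) :- u :* t :* d :* d) ≋-refl (const u) (const (+ n)) d t)) ⟩
    const u ⊗ ((const (+ n) ⊕ t ⊗ d) ⊗ d) ⊖ const u ⊗ t ⊗ d ⊗ d ⊖ const h ⊗ const (+ p) ⊗ d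
      ≈⟨ ℤ[x]/G.+-congʳ {negP (const h ⊗ const (+ p) ⊗ d)} (ℤ[x]/G.+-cong
           (ℤ[x]/G.*-congˡ {const u} vanish)
           (ℤ[x]/G.-‿cong {const u ⊗ t ⊗ d ⊗ d} (ℤ[x]/G.*-congʳ {d} (ℤ[x]/G.*-congˡ {const u ⊗ t} y-1)))) ⟩
    const u ⊗ [] ⊖ const u ⊗ t ⊗ (const (+ p) ⊗ c) ⊗ d ⊖ const h ⊗ const (+ p) ⊗ d
      ≈⟨ lift (⊕-congʳ (negP (const h ⊗ const (+ p) ⊗ d)) (⊕-congʳ (negP (const u ⊗ t ⊗ (const (+ p) ⊗ c) ⊗ d)) (⊗-zeroʳ (const u)))) ⟩
    negP (const u ⊗ t ⊗ (const (+ p) ⊗ c) ⊗ d) ⊖ const h ⊗ const (+ p) ⊗ d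
      ≈⟨ lift (solve 5 (λ x p c d h → :- (x :* (p :* c) :* d) :- h :* p :* d
           := p :* (:- (h :+ x :* c)) :* d) ≋-refl (const u ⊗ t) (const (+ p)) c d (const h)) ⟩
    const (+ p) ⊗ negP (const h ⊕ const u ⊗ t ⊗ c) ⊗ d ∎))
    where
    open ℤ[x]/G-Reasoning
    d = y ⊖ oneP
    un≋ : const u ⊗ const (+ n) ≋ oneP ⊕ const h ⊗ const (+ p)
    un≋ = ≋-trans (≋-sym (const-* u (+ n))) (subst (λ x → const x ≋ oneP ⊕ const h ⊗ const (+ p)) (sym un≡)
            (⊕-congˡ oneP (const-* h (+ p))))
    vanish : (const (+ n) ⊕ t ⊗ d) ⊗ d ≈ᴳ []
    vanish = begin
      (const (+ n) ⊕ t ⊗ d) ⊗ d  ≈⟨ lift (⊗-congʳ d t≋) ⟨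
      geom y n ⊗ d               ≈⟨ lift (geom-telescope y n) ⟩
      y ^P n ⊖ oneP              ≡⟨ cong (_⊖ oneP) (^P≡^ᴳ y n) ⟩
      y ^ᴳ n ⊖ oneP              ≈⟨ difference-≈ᴳ0 y^n ⟩
      []                         ∎

  -- Reduced to the case of 1 by the twist χ s. It is again a (2m)-th root of unity because s² = 1
  -- and the exponent is even, and χ s - 1 = (χ - s) s with χ and s both congruent to `b` modulo
  -- `p`.
  root-of-unity≡sign : ∀ {p m χ s b c} u h → 1 < p → u ℤ.* + (2 * m) ≡ + 1 ℤ.+ h ℤ.* + p →
                       s ℤ.* s ≡ + 1 → χ ^ᴳ (2 * m) ≈ᴳ oneP → b ⊖ χ ≈ᴳ const (+ p) ⊗ c →
                       ∃[ c′ ] b ≈ᴳ const s ⊕ const (+ p) ⊗ c′ → χ ≈ᴳ const s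
  root-of-unity≡sign {p} {m} {χ} {s} {b} {c} u h 1<p un≡ ss≡1 χ^2m b-χ (c′ , b≈) = begin
    χ                         ≈⟨ lift (solve 1 (λ x → x := x :* con (+ 1)) ≋-refl χ) ⟩
    χ ⊗ oneP                  ≈⟨ ℤ[x]/G.*-congˡ {χ} (lift ss≋1) ⟨
    χ ⊗ (const s ⊗ const s)   ≈⟨ lift (≋-sym (⊗-assoc χ (const s) (const s))) ⟩
    χ ⊗ const s ⊗ const s     ≈⟨ ℤ[x]/G.*-congʳ {const s} (root-of-unity≡1 u h ((c′ ⊖ c) ⊗ const s) 1<p un≡ power near) ⟩
    oneP ⊗ const s            ≈⟨ ℤ[x]/G.*-identityˡ (const s) ⟩
    const s                   ∎
    where
    open ℤ[x]/G-Reasoning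
    ss≋1 : const s ⊗ const s ≋ oneP
    ss≋1 = ≋-trans (≋-sym (const-* s s)) (subst (λ x → const x ≋ oneP) (sym ss≡1) ≋-refl)
    power : (χ ⊗ const s) ^ᴳ (2 * m) ≈ᴳ oneP
    power = begin
      (χ ⊗ const s) ^ᴳ (2 * m)           ≈⟨ ^ᴳ-distrib-* χ (const s) (2 * m) ⟩
      χ ^ᴳ (2 * m) ⊗ const s ^ᴳ (2 * m)  ≈⟨ ℤ[x]/G.*-cong χ^2m (ℤ[x]/G.sym (^ᴳ-assocʳ (const s) 2 m)) ⟩
      oneP ⊗ (const s ^ᴳ 2) ^ᴳ m         ≈⟨ ℤ[x]/G.*-identityˡ _ ⟩
      (const s ^ᴳ 2) ^ᴳ m                ≈⟨ ^ᴳ-congˡ m (ℤ[x]/G.trans (ℤ[x]/G.*-congˡ {const s} (ℤ[x]/G.*-identityʳ (const s))) (lift ss≋1)) ⟩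
      oneP ^ᴳ m                          ≈⟨ 1^ᴳ m ⟩
      oneP                               ∎
    near : χ ⊗ const s ⊖ oneP ≈ᴳ const (+ p) ⊗ ((c′ ⊖ c) ⊗ const s)
    near = begin
      χ ⊗ const s ⊖ oneP
        ≈⟨ ℤ[x]/G.+-congˡ {χ ⊗ const s} (ℤ[x]/G.-‿cong (lift ss≋1)) ⟨
      χ ⊗ const s ⊖ const s ⊗ const s
        ≈⟨ lift (solve 3 (λ χ s b → χ :* s :- s :* s := (b :- (b :- χ) :- s) :* s) ≋-refl χ (const s) b) ⟩
      (b ⊖ (b ⊖ χ) ⊖ const s) ⊗ const s
        ≈⟨ ℤ[x]/G.*-congʳ {const s} (ℤ[x]/G.+-congʳ {negP (const s)} (ℤ[x]/G.+-cong b≈ (ℤ[x]/G.-‿cong b-χ))) ⟩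
      ((const s ⊕ const (+ p) ⊗ c′) ⊖ const (+ p) ⊗ c ⊖ const s) ⊗ const s
        ≈⟨ lift (solve 4 (λ s p c′ c → ((s :+ p :* c′) :- p :* c :- s) :* s := p :* ((c′ :- c) :* s))
             ≋-refl (const s) (const (+ p)) c′ c) ⟩
      const (+ p) ⊗ ((c′ ⊖ c) ⊗ const s) ∎

-- The product over power residues

∤⇒coprime : ∀ {p n} → Prime p → ¬ p ∣ n → Coprime n p
∤⇒coprime p-prime p∤n (d∣n , d∣p) with prime⇒irreducible p-prime d∣p
... | inj₁ d≡1  = d≡1
... | inj₂ refl = contradiction d∣n p∤n

module Product-formula
  {m p q : ℕ} (1≤m : 1 ≤ m) (p-prime : Prime p) (p∸1≡ : p ∸ 1 ≡ q * (2 * m)) (2-residue : IsPowerResidue m p (+ 2))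
  {G : Poly} {degree : ℕ} (M : Monic G degree)
  {i z : Poly} (i²≈-1 : Monic-quotient._≈ᴳ_ M (i ⊗ i) (negP oneP)) (Σz≈0 : Monic-quotient._≈ᴳ_ M (geom z p) [])
  {a : ℕ} (p∤a : ¬ p ∣ a)
  where

  open Monic-quotient M
  open Power-residues {m} {p} {q} 1≤m p-prime p∸1≡
  open Prime-field p-prime using (1<p; _≡ₚ_)
  private
    module 𝔸 = ℤ[x]/G
    module ∏ᴬ = Products 𝔸.*-commutativeMonoid
  open Cancellation ℤ[x]/G using (Cancellable)
  open ℤ[x]/G-Reasoning

  z^p≈1 : z ^ᴳ p ≈ᴳ oneP
  z^p≈1 = ≈ᴳ0-difference (begin
    z ^ᴳ p ⊖ oneP           ≡⟨ cong (_⊖ oneP) (^P≡^ᴳ z p) ⟨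
    z ^P p ⊖ oneP           ≈⟨ lift (geom-telescope z p) ⟨
    geom z p ⊗ (z ⊖ oneP)   ≈⟨ 𝔸.*-congʳ {z ⊖ oneP} Σz≈0 ⟩
    []                      ∎)

  -- On an element fixed by `z` the geometric sum acts as `p`. As that sum is zero, p d = 0, and
  -- there is no torsion.
  fixed⇒0 : ∀ {d} → z ⊗ d ≈ᴳ d → d ≈ᴳ []
  fixed⇒0 {d} zd≈d = torsion-free {+ p} {d} (λ e → ℕₚ.<⇒≢ (ℕₚ.<-trans (s≤s z≤n) 1<p) (sym (ℤₚ.+-injective e))) (begin
    const (+ p) ⊗ d  ≈⟨ geom-fixed p ⟨
    geom z p ⊗ d     ≈⟨ 𝔸.*-congʳ {d} Σz≈0 ⟩
    []               ∎)
    where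
    geom-fixed : ∀ n → geom z n ⊗ d ≈ᴳ const (+ n) ⊗ d
    geom-fixed zero    = lift (≋-sym (≋-trans (const-⊗ (+ 0) d) (scale-0 d)))
    geom-fixed (suc n) = begin
      (oneP ⊕ z ⊗ geom z n) ⊗ d
        ≈⟨ lift (solve 3 (λ z s d → (con (+ 1) :+ z :* s) :* d := d :+ z :* (s :* d)) ≋-refl z (geom z n) d) ⟩
      d ⊕ z ⊗ (geom z n ⊗ d)
        ≈⟨ 𝔸.+-congˡ {d} (𝔸.*-congˡ {z} (geom-fixed n)) ⟩
      d ⊕ z ⊗ (const (+ n) ⊗ d)
        ≈⟨ lift (solve 3 (λ z n d → d :+ z :* (n :* d) := d :+ n :* (z :* d)) ≋-refl z (const (+ n)) d) ⟩
      d ⊕ const (+ n) ⊗ (z ⊗ d)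
        ≈⟨ 𝔸.+-congˡ {d} (𝔸.*-congˡ {const (+ n)} zd≈d) ⟩
      d ⊕ const (+ n) ⊗ d
        ≈⟨ lift (solve 2 (λ n d → d :+ n :* d := (con (+ 1) :+ n) :* d) ≋-refl (const (+ n)) d) ⟩
      const (+ suc n) ⊗ d ∎

  power-fixed : ∀ {y d} → y ⊗ d ≈ᴳ d → ∀ n → y ^ᴳ n ⊗ d ≈ᴳ d
  power-fixed {y} {d} e zero    = 𝔸.*-identityˡ d
  power-fixed {y} {d} e (suc n) = begin
    (y ⊗ y ^ᴳ n) ⊗ d  ≈⟨ 𝔸.*-assoc y (y ^ᴳ n) d ⟩
    y ⊗ (y ^ᴳ n ⊗ d)  ≈⟨ 𝔸.*-congˡ {y} (power-fixed e n) ⟩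
    y ⊗ d             ≈⟨ e ⟩
    d                 ∎

  z^[n*p]≈1 : ∀ n → z ^ᴳ (n * p) ≈ᴳ oneP
  z^[n*p]≈1 n = begin
    z ^ᴳ (n * p)     ≡⟨ cong (z ^ᴳ_) (ℕₚ.*-comm n p) ⟩
    z ^ᴳ (p * n)     ≈⟨ ^ᴳ-assocʳ z p n ⟨
    (z ^ᴳ p) ^ᴳ n    ≈⟨ ^ᴳ-congˡ n z^p≈1 ⟩
    oneP ^ᴳ n        ≈⟨ 1^ᴳ n ⟩
    oneP             ∎

  -- Since `e` is invertible modulo `p`, `z` is itself a power of z^e up to factors z^p = 1, so it
  -- fixes `d` as well.
  coprime-power-fixed⇒0 : ∀ {d} e → Coprime e p → z ^ᴳ e ⊗ d ≈ᴳ d → d ≈ᴳ []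
  coprime-power-fixed⇒0 {d} e e⊥p fixed = fixed⇒0 (go (coprime-Bézout e⊥p))
    where
    multiple-fixed : ∀ x → z ^ᴳ (x * e) ⊗ d ≈ᴳ d
    multiple-fixed x = begin
      z ^ᴳ (x * e) ⊗ d    ≡⟨ cong (λ n → z ^ᴳ n ⊗ d) (ℕₚ.*-comm x e) ⟩
      z ^ᴳ (e * x) ⊗ d    ≈⟨ 𝔸.*-congʳ {d} (^ᴳ-assocʳ z e x) ⟨
      (z ^ᴳ e) ^ᴳ x ⊗ d   ≈⟨ power-fixed fixed x ⟩
      d                   ∎
    go : Bézout.Identity 1 e p → z ⊗ d ≈ᴳ d
    go (Bézout.+- x y eq) = begin
      z ⊗ d                      ≈⟨ 𝔸.*-congʳ {d} (𝔸.*-identityʳ z) ⟨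
      (z ⊗ oneP) ⊗ d             ≈⟨ 𝔸.*-congʳ {d} (𝔸.*-congˡ {z} (z^[n*p]≈1 y)) ⟨
      z ^ᴳ (1 + y * p) ⊗ d       ≡⟨ cong (λ n → z ^ᴳ n ⊗ d) eq ⟩
      z ^ᴳ (x * e) ⊗ d           ≈⟨ multiple-fixed x ⟩
      d                          ∎
    go (Bézout.-+ x y eq) = begin
      z ⊗ d                      ≈⟨ 𝔸.*-congˡ {z} (multiple-fixed x) ⟨
      z ⊗ (z ^ᴳ (x * e) ⊗ d)     ≈⟨ 𝔸.*-assoc z (z ^ᴳ (x * e)) d ⟨
      z ^ᴳ (1 + x * e) ⊗ d       ≡⟨ cong (λ n → z ^ᴳ n ⊗ d) eq ⟩
      z ^ᴳ (y * p) ⊗ d           ≈⟨ 𝔸.*-congʳ {d} (z^[n*p]≈1 y) ⟩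
      oneP ⊗ d                   ≈⟨ 𝔸.*-identityˡ d ⟩
      d                          ∎

  ω : Poly
  ω = z ^ᴳ a

  ω^p≈1 : ω ^ᴳ p ≈ᴳ oneP
  ω^p≈1 = 𝔸.trans (^ᴳ-assocʳ z a p) (z^[n*p]≈1 a)

  -- The exponent `p ∸ k` stands for -k, exponents being natural numbers. Only arguments up to `p`
  -- occur, where the subtraction is exact.
  U V : ℕ → Poly
  U k = ω ^ᴳ k ⊖ ω ^ᴳ (p ∸ k)
  V k = ω ^ᴳ k ⊕ ω ^ᴳ (p ∸ k)

  module _ {h : ℕ} (h∈ : h ∈ half) where
    private
      h<p  = half-< h∈
      2h<p = proj₂ (half⁻ h∈)
      x = ω ^ᴳ h
      y = ω ^ᴳ (p ∸ h)

    ω^h*ω^[p∸h] : x ⊗ y ≈ᴳ oneP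
    ω^h*ω^[p∸h] = begin
      x ⊗ y                ≈⟨ ^ᴳ-homo-* ω h (p ∸ h) ⟨
      ω ^ᴳ (h + (p ∸ h))   ≡⟨ cong (ω ^ᴳ_) (ℕₚ.m+[n∸m]≡n (ℕₚ.<⇒≤ h<p)) ⟩
      ω ^ᴳ p               ≈⟨ ω^p≈1 ⟩
      oneP                 ∎

    U-double : U (2 * h) ≈ᴳ V h ⊗ U h
    U-double = begin
      ω ^ᴳ (2 * h) ⊖ ω ^ᴳ (p ∸ 2 * h)   ≈⟨ 𝔸.+-cong xx (𝔸.-‿cong yy) ⟩
      x ⊗ x ⊖ y ⊗ y                     ≈⟨ lift (solve 2 (λ x y → x :* x :- y :* y := (x :+ y) :* (x :- y)) ≋-refl x y) ⟩
      V h ⊗ U h                         ∎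
      where
      xx : ω ^ᴳ (2 * h) ≈ᴳ x ⊗ x
      xx = begin
        ω ^ᴳ (2 * h)   ≡⟨ cong (λ n → ω ^ᴳ (h + n)) (ℕₚ.+-identityʳ h) ⟩
        ω ^ᴳ (h + h)   ≈⟨ ^ᴳ-homo-* ω h h ⟩
        x ⊗ x          ∎
      -- A factor ω^p = 1 raises the exponent from p - 2h to 2 (p - h).
      yy : ω ^ᴳ (p ∸ 2 * h) ≈ᴳ y ⊗ y
      yy = begin
        ω ^ᴳ (p ∸ 2 * h)              ≈⟨ 𝔸.*-identityˡ (ω ^ᴳ (p ∸ 2 * h)) ⟨
        oneP ⊗ ω ^ᴳ (p ∸ 2 * h)       ≈⟨ 𝔸.*-congʳ {ω ^ᴳ (p ∸ 2 * h)} ω^p≈1 ⟨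
        ω ^ᴳ p ⊗ ω ^ᴳ (p ∸ 2 * h)     ≈⟨ ^ᴳ-homo-* ω p (p ∸ 2 * h) ⟨
        ω ^ᴳ (p + (p ∸ 2 * h))        ≡⟨ cong (ω ^ᴳ_) exponent ⟩
        ω ^ᴳ ((p ∸ h) + (p ∸ h))      ≈⟨ ^ᴳ-homo-* ω (p ∸ h) (p ∸ h) ⟩
        y ⊗ y                         ∎
        where
        exponent : p + (p ∸ 2 * h) ≡ (p ∸ h) + (p ∸ h)
        exponent = ℕₚ.+-cancelʳ-≡ (2 * h) _ _ (trans
          (trans (ℕₚ.+-assoc p (p ∸ 2 * h) (2 * h)) (cong (ℕ._+_ p) (ℕₚ.m∸n+n≡m (ℕₚ.<⇒≤ 2h<p))))
          (sym (trans (solveℕ 2 (λ k h → (k +ℕ k) +ℕ conℕ 2 *ℕ h =ℕ (k +ℕ h) +ℕ (k +ℕ h)) refl (p ∸ h) h)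
            (cong₂ _+_ (ℕₚ.m∸n+n≡m (ℕₚ.<⇒≤ h<p)) (ℕₚ.m∸n+n≡m (ℕₚ.<⇒≤ h<p))))))

    U-reflect : U (p ∸ 2 * h) ≈ᴳ negP (U (2 * h))
    U-reflect = begin
      ω ^ᴳ (p ∸ 2 * h) ⊖ ω ^ᴳ (p ∸ (p ∸ 2 * h))
        ≡⟨ cong (λ n → ω ^ᴳ (p ∸ 2 * h) ⊖ ω ^ᴳ n) (ℕₚ.m∸[m∸n]≡n (ℕₚ.<⇒≤ 2h<p)) ⟩
      ω ^ᴳ (p ∸ 2 * h) ⊖ ω ^ᴳ (2 * h)
        ≈⟨ lift (solve 2 (λ x y → x :- y := :- (y :- x)) ≋-refl (ω ^ᴳ (p ∸ 2 * h)) (ω ^ᴳ (2 * h))) ⟩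
      negP (U (2 * h)) ∎

    -- If (x - y) d = 0, then x² d = x y d = d. Here x² is z to the power 2ah, and `p` divides
    -- neither `a` nor 2h, as 0 < 2h < p.
    U-cancellable : Cancellable (U h)
    U-cancellable {f} {g} e = ≈ᴳ0-difference (coprime-power-fixed⇒0 (a * (h + h)) (∤⇒coprime p-prime p∤) (begin
      z ^ᴳ (a * (h + h)) ⊗ d     ≈⟨ 𝔸.*-congʳ {d} (^ᴳ-assocʳ z a (h + h)) ⟨
      ω ^ᴳ (h + h) ⊗ d           ≈⟨ 𝔸.*-congʳ {d} (^ᴳ-homo-* ω h h) ⟩
      (x ⊗ x) ⊗ d                ≈⟨ lift (solve 4 (λ x y f g → (x :* x) :* (f :- g)
                                      := x :* ((x :- y) :* f :- (x :- y) :* g) :+ (x :* y) :* (f :- g)) ≋-refl x y f g) ⟩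
      x ⊗ (U h ⊗ f ⊖ U h ⊗ g) ⊕ (x ⊗ y) ⊗ d
                                 ≈⟨ 𝔸.+-cong (𝔸.*-congˡ {x} (difference-≈ᴳ0 e)) (𝔸.*-congʳ {d} ω^h*ω^[p∸h]) ⟩
      x ⊗ [] ⊕ oneP ⊗ d          ≈⟨ lift (≋-trans (⊕-cong (⊗-zeroʳ x) (⊗-identityˡ d)) ≋-refl) ⟩
      d                          ∎))
      where
      d = f ⊖ g
      p∤ : ¬ p ∣ a * (h + h)
      p∤ p∣ with euclidsLemma a (h + h) p-prime p∣
      ... | inj₁ p∣a  = p∤a p∣a
      ... | inj₂ p∣2h = contradiction (ℕD.∣⇒≤ {{ℕ.>-nonZero (ℕₚ.≤-trans (half-positive h∈) (ℕₚ.m≤m+n h h))}} p∣2h)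
                          (ℕₚ.<⇒≱ (subst (_< p) (cong (ℕ._+_ h) (ℕₚ.+-identityʳ h)) 2h<p))

    -- The terms i² = -1 and s² x y = 1 cancel, leaving the cross term. The sign `s` lets one
    -- computation serve both products of the theorem.
    paired-factors : ∀ s → s ℤ.* s ≡ + 1 → (i ⊕ const s ⊗ x) ⊗ (i ⊕ const s ⊗ y) ≈ᴳ (const s ⊗ i) ⊗ V h
    paired-factors s ss≡1 = begin
      (i ⊕ const s ⊗ x) ⊗ (i ⊕ const s ⊗ y)
        ≈⟨ lift (solve 4 (λ i s x y → (i :+ s :* x) :* (i :+ s :* y)
             := (i :* i :+ (s :* s) :* (x :* y)) :+ (s :* i) :* (x :+ y)) ≋-refl i (const s) x y) ⟩
      (i ⊗ i ⊕ (const s ⊗ const s) ⊗ (x ⊗ y)) ⊕ (const s ⊗ i) ⊗ V h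
        ≈⟨ 𝔸.+-congʳ {(const s ⊗ i) ⊗ V h} (𝔸.+-cong i²≈-1 (𝔸.*-cong ss≈1 ω^h*ω^[p∸h])) ⟩
      (negP oneP ⊕ oneP ⊗ oneP) ⊕ (const s ⊗ i) ⊗ V h
        ≈⟨ lift (solve 1 (λ w → (:- con (+ 1) :+ con (+ 1) :* con (+ 1)) :+ w := w) ≋-refl ((const s ⊗ i) ⊗ V h)) ⟩
      (const s ⊗ i) ⊗ V h ∎
      where
      ss≈1 : const s ⊗ const s ≈ᴳ oneP
      ss≈1 = lift (≋-trans (≋-sym (const-* s s)) (subst (λ c → const c ≋ oneP) (sym ss≡1) ≋-refl))

  module _ (s : ℤ) (ss≡1 : s ℤ.* s ≡ + 1) where

    private
      -- This sign is at once the factor of i^q in the product and the residue of (2s)^q modulo `p`.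
      e = s ℤ.^ q ℤ.* (ℤ.- + 1) ℤ.^ flips

      f : ℕ → Poly
      f k = i ⊕ const s ⊗ ω ^ᴳ k

    product-over-residues : ∏ᴬ.∏ f (R m p) ≈ᴳ const e ⊗ i ^P q
    product-over-residues = begin
      ∏ᴬ.∏ f (R m p)
        ≈⟨ ∏ᴬ.∏-↭ f R-↭ ⟩
      ∏ᴬ.∏ f (half ++ map (p ∸_) half)
        ≈⟨ ∏ᴬ.∏-++ f half (map (p ∸_) half) ⟩
      ∏ᴬ.∏ f half ⊗ ∏ᴬ.∏ f (map (p ∸_) half)
        ≡⟨ cong (∏ᴬ.∏ f half ⊗_) (∏ᴬ.∏-map f (p ∸_) half) ⟩
      ∏ᴬ.∏ f half ⊗ ∏ᴬ.∏ (λ h → f (p ∸ h)) half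
        ≈⟨ ∏ᴬ.∏-∙ f (λ h → f (p ∸ h)) half ⟨
      ∏ᴬ.∏ (λ h → f h ⊗ f (p ∸ h)) half
        ≈⟨ ∏ᴬ.∏-cong half (λ h∈ → paired-factors h∈ s ss≡1) ⟩
      ∏ᴬ.∏ (λ h → (const s ⊗ i) ⊗ V h) half
        ≈⟨ ∏ᴬ.∏-∙ (λ _ → const s ⊗ i) V half ⟩
      ∏ᴬ.∏ (λ _ → const s ⊗ i) half ⊗ ∏ᴬ.∏ V half
        ≈⟨ 𝔸.*-cong constant (gauss ℤ[x]/G U V (fold-↭ 2-residue) U-double U-reflect (λ h∈ → U-cancellable h∈)) ⟩
      (const (s ℤ.^ q) ⊗ i ^P q) ⊗ negP oneP ^ᴳ flips
        ≈⟨ 𝔸.*-congˡ {const (s ℤ.^ q) ⊗ i ^P q} (const-^ᴳ (ℤ.- + 1) flips) ⟨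
      (const (s ℤ.^ q) ⊗ i ^P q) ⊗ const ((ℤ.- + 1) ℤ.^ flips)
        ≈⟨ lift (solve 3 (λ s i t → (s :* i) :* t := (s :* t) :* i) ≋-refl (const (s ℤ.^ q)) (i ^P q) (const ((ℤ.- + 1) ℤ.^ flips))) ⟩
      (const (s ℤ.^ q) ⊗ const ((ℤ.- + 1) ℤ.^ flips)) ⊗ i ^P q
        ≈⟨ 𝔸.*-congʳ {i ^P q} (lift (const-* (s ℤ.^ q) ((ℤ.- + 1) ℤ.^ flips))) ⟨
      const e ⊗ i ^P q ∎
      where
      constant : ∏ᴬ.∏ (λ _ → const s ⊗ i) half ≈ᴳ const (s ℤ.^ q) ⊗ i ^P q
      constant = begin
        ∏ᴬ.∏ (λ _ → const s ⊗ i) half    ≡⟨ ∏ᴬ.∏-const (const s ⊗ i) half ⟩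
        (const s ⊗ i) ^ᴳ length half     ≡⟨ cong ((const s ⊗ i) ^ᴳ_) length-half ⟩
        (const s ⊗ i) ^ᴳ q               ≈⟨ ^ᴳ-distrib-* (const s) i q ⟩
        const s ^ᴳ q ⊗ i ^ᴳ q            ≈⟨ 𝔸.*-congʳ {i ^ᴳ q} (const-^ᴳ s q) ⟨
        const (s ℤ.^ q) ⊗ i ^ᴳ q         ≡⟨ cong (const (s ℤ.^ q) ⊗_) (^P≡^ᴳ i q) ⟨
        const (s ℤ.^ q) ⊗ i ^P q         ∎

    symbol : ∀ {χ c} → χ ^P (2 * m) ≈ᴳ oneP → const ((s ℤ.* + 2) ℤ.^ q) ⊖ χ ≈ᴳ scale (+ p) c → χ ≈ᴳ const e
    symbol {χ} {c} root near = root-of-unity≡sign {p} {m} {χ} {e} {const b} {c}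
        (ℤ.- + q) (ℤ.- + 1) 1<p inverse ee≡1
        (subst (_≈ᴳ oneP) (^P≡^ᴳ χ (2 * m)) root)
        (𝔸.trans near (lift (≋-sym (const-⊗ (+ p) c))))
        (const (s ℤ.^ q ℤ.* h) , lift (subst (λ x → const x ≋ const e ⊕ const (+ p) ⊗ const (s ℤ.^ q ℤ.* h)) (sym b≡)
          (⊕-congˡ (const e) (const-* (+ p) (s ℤ.^ q ℤ.* h)))))
      where
      h = _≡ₚ_.multiplier (2^q 2-residue)
      2^q≡ = _≡ₚ_.equality (2^q 2-residue)
      b = (s ℤ.* + 2) ℤ.^ q
      b≡ : b ≡ e ℤ.+ + p ℤ.* (s ℤ.^ q ℤ.* h)
      b≡ = trans (*-^-distrib s (+ 2) q) (trans (cong (ℤ._*_ (s ℤ.^ q)) 2^q≡)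
        (solveℤ 4 (λ s t h p → s *ℤ (t +ℤ h *ℤ p) =ℤ s *ℤ t +ℤ p *ℤ (s *ℤ h)) refl (s ℤ.^ q) ((ℤ.- + 1) ℤ.^ flips) h (+ p)))
      square : ∀ t n → t ℤ.* t ≡ + 1 → t ℤ.^ n ℤ.* t ℤ.^ n ≡ + 1
      square t n tt≡1 = trans (sym (*-^-distrib t t n)) (trans (cong (ℤ._^ n) tt≡1) (ℤₚ.^-zeroˡ n))
      ee≡1 : e ℤ.* e ≡ + 1
      ee≡1 = trans (solveℤ 2 (λ s t → (s *ℤ t) *ℤ (s *ℤ t) =ℤ (s *ℤ s) *ℤ (t *ℤ t)) refl (s ℤ.^ q) ((ℤ.- + 1) ℤ.^ flips))
        (cong₂ ℤ._*_ (square s q ss≡1) (square (ℤ.- + 1) flips refl))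
      inverse : (ℤ.- + q) ℤ.* + (2 * m) ≡ + 1 ℤ.+ (ℤ.- + 1) ℤ.* + p
      inverse = trans (sym (ℤₚ.neg-distribˡ-* (+ q) (+ (2 * m)))) (trans (cong ℤ.-_ (sym (ℤₚ.pos-* q (2 * m))))
        (trans (cong (λ n → ℤ.- + n) (sym p∸1≡)) (trans (cong ℤ.-_ (+-∸ (ℕₚ.<⇒≤ 1<p)))
        (solveℤ 1 (λ p → -ℤ (p +ℤ -ℤ conℤ (+ 1)) =ℤ conℤ (+ 1) +ℤ conℤ (ℤ.- + 1) *ℤ p) refl (+ p)))))

    product-formula : ∀ {χ c} → χ ^P (2 * m) ≈ᴳ oneP → const ((s ℤ.* + 2) ℤ.^ q) ⊖ χ ≈ᴳ scale (+ p) c →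
                      ∏ᴬ.∏ f (R m p) ≈ᴳ χ ⊗ i ^P q
    product-formula {χ} {c} root near = begin
      ∏ᴬ.∏ f (R m p)     ≈⟨ product-over-residues ⟩
      const e ⊗ i ^P q   ≈⟨ 𝔸.*-congʳ {i ^P q} (symbol {χ} {c} root near) ⟨
      χ ⊗ i ^P q         ∎

-- X^(p m) and X^(4 m) represent i and a primitive p-th root of unity when N = 4 p m.
module Roots-in-ℤ[ζ] {m p : ℕ} (1≤m : 1 ≤ m) (p-prime : Prime p) where

  private instance
    _ = prime⇒nonZero p-prime
    _ = prime⇒nonTrivial p-prime
    _ = ℕ.>-nonZero 1≤m

  N : ℕ
  N = 4 * p * m

  N≡2*2pm : N ≡ 2 * (2 * (p * m))
  N≡2*2pm = solveℕ 2 (λ p m → conℕ 4 *ℕ p *ℕ m =ℕ conℕ 2 *ℕ (conℕ 2 *ℕ (p *ℕ m))) refl p m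

  N≡p*4m : N ≡ p * (4 * m)
  N≡p*4m = solveℕ 2 (λ p m → conℕ 4 *ℕ p *ℕ m =ℕ p *ℕ (conℕ 4 *ℕ m)) refl p m

  private
    positive : ∀ j k .{{_ : ℕ.NonZero j}} .{{_ : ℕ.NonZero k}} → 1 ≤ j * k
    positive j k = ℕ.>-nonZero⁻¹ (j * k) {{ℕₚ.m*n≢0 j k}}

    1<p : 1 < p
    1<p = ℕ.nonTrivial⇒n>1 p

    1≤pm : 1 ≤ p * m
    1≤pm = positive p m

    1≤2pm : 1 ≤ 2 * (p * m)
    1≤2pm = ℕₚ.≤-trans 1≤pm (ℕₚ.m≤n*m (p * m) 2)

    1≤4m : 1 ≤ 4 * m
    1≤4m = ℕₚ.≤-trans 1≤m (ℕₚ.m≤n*m m 4)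

  1≤N : 1 ≤ N
  1≤N = subst (1 ≤_) (sym N≡2*2pm) (ℕₚ.≤-trans 1≤2pm (ℕₚ.m≤n*m (2 * (p * m)) 2))

  Φ-monic-N : Monic (Φ N) (Cyclotomic.degree (cyclotomic N 1≤N))
  Φ-monic-N = Cyclotomic.Φ-monic (cyclotomic N 1≤N)

  Φ∣geom-N : ∀ {g k} → N ≡ k * g → 1 ≤ g → 1 < k → Φ N ∣ᴾ geom (X^ g) k
  Φ∣geom-N {g} {k} e 1≤g 1<k = subst (λ n → Φ n ∣ᴾ geom (X^ g) k) (sym e)
    (Φ∣geom {g} {k} (cyclotomic g 1≤g) (cyclotomic (k * g) (subst (1 ≤_) e 1≤N)) 1≤g
      (subst (g <_) (ℕₚ.*-comm g k) (ℕₚ.m<m*n g k {{ℕ.>-nonZero 1≤g}} 1<k)))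

  open Monic-quotient Φ-monic-N

  Σζ≈0 : geom (X^ (4 * m)) p ≈ᴳ []
  Σζ≈0 = ∣⇒≈ᴳ0 (Φ∣geom-N {4 * m} {p} N≡p*4m 1≤4m 1<p)

  i²≈-1 : X^ (p * m) ⊗ X^ (p * m) ≈ᴳ negP oneP
  i²≈-1 = ≈ᴳ0-difference (begin
    i ⊗ i ⊖ negP oneP            ≈⟨ lift (solve 1 (λ x → x :- (:- con (+ 1)) := con (+ 1) :+ x) ≋-refl (i ⊗ i)) ⟩
    oneP ⊕ i ⊗ i                 ≈⟨ lift (⊕-congˡ oneP (X^-+ (p * m) (p * m))) ⟨
    oneP ⊕ X^ (p * m + p * m)    ≡⟨ cong (λ n → oneP ⊕ X^ (p * m + n)) (ℕₚ.+-identityʳ (p * m)) ⟨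
    oneP ⊕ X^ (2 * (p * m))      ≈⟨ lift (geom-2 (X^ (2 * (p * m)))) ⟨
    geom (X^ (2 * (p * m))) 2    ≈⟨ ∣⇒≈ᴳ0 (Φ∣geom-N {2 * (p * m)} {2} N≡2*2pm 1≤2pm (s≤s (s≤s z≤n))) ⟩
    []                           ∎)
    where
    open ℤ[x]/G-Reasoning
    i = X^ (p * m)
    geom-2 : ∀ y → geom y 2 ≋ oneP ⊕ y
    geom-2 y = ⊕-congˡ oneP (≋-trans (⊗-congˡ y (⊕-congˡ oneP (⊗-zeroʳ y)))
      (CommutativeRing.*-identityʳ polyRing y))

  ζpow-exponent : ∀ a → ¬ + p ℤD.∣ a →
    ∃[ a′ ] ¬ p ∣ a′ × (∀ k → ζpow N (+ (4 * m * k) ℤ.* a) ≡ X^ (a′ * k * (4 * m)))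
  ζpow-exponent (+ n) p∤a = n , p∤a , λ k → trans
    (cong (ζpow N) (sym (ℤₚ.pos-* (4 * m * k) n)))
    (cong X^ (solveℕ 3 (λ m k n → conℕ 4 *ℕ m *ℕ k *ℕ n =ℕ n *ℕ k *ℕ (conℕ 4 *ℕ m)) refl m k n))
  ζpow-exponent -[1+ n ] p∤a = (N ∸ 1) * suc n , p∤ , λ k → trans (negative (4 * m * k))
    (cong X^ (solveℕ 4 (λ N m k n → N *ℕ (conℕ 4 *ℕ m *ℕ k *ℕ n) =ℕ N *ℕ n *ℕ k *ℕ (conℕ 4 *ℕ m)) refl (N ∸ 1) m k (suc n)))
    where
    negative : ∀ M → ζpow N (+ M ℤ.* -[1+ n ]) ≡ X^ ((N ∸ 1) * (M * suc n))
    negative zero    = cong X^ (sym (ℕₚ.*-zeroʳ (N ∸ 1)))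
    negative (suc M) = refl
    p∤ : ¬ p ∣ (N ∸ 1) * suc n
    p∤ p∣ with euclidsLemma (N ∸ 1) (suc n) p-prime p∣
    ... | inj₁ p∣N∸1 = contradiction
      (ℕD.∣⇒≤ (ℕD.∣m+n∣m⇒∣n (subst (p ∣_) (sym (ℕₚ.m∸n+n≡m 1≤N)) (divides (4 * m) (trans N≡p*4m (ℕₚ.*-comm p (4 * m))))) p∣N∸1))
      (ℕₚ.<⇒≱ 1<p)
    ... | inj₂ p∣a = p∤a p∣a

  ζpow-power : ∀ a → ¬ + p ℤD.∣ a →
    ∃[ a′ ] ¬ p ∣ a′ × (∀ k → ζpow N (+ (4 * m * k) ℤ.* a) ≈ᴳ (X^ (4 * m) ^ᴳ a′) ^ᴳ k)
  ζpow-power a p∤a = let a′ , p∤a′ , exponent = ζpow-exponent a p∤a in a′ , p∤a′ , λ k → begin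
    ζpow N (+ (4 * m * k) ℤ.* a)   ≡⟨ exponent k ⟩
    X^ (a′ * k * (4 * m))          ≈⟨ lift (X^-* (4 * m) (a′ * k)) ⟨
    X^ (4 * m) ^P (a′ * k)         ≡⟨ ^P≡^ᴳ (X^ (4 * m)) (a′ * k) ⟩
    X^ (4 * m) ^ᴳ (a′ * k)         ≈⟨ ^ᴳ-assocʳ (X^ (4 * m)) a′ k ⟨
    (X^ (4 * m) ^ᴳ a′) ^ᴳ k        ∎
    where open ℤ[x]/G-Reasoning

open Defs using (_≈⟨_⟩_)

theorem1p2 : (m p : ℕ) → 1 ≤ m → Prime p
    → (q : ℕ) → p ∸ 1 ≡ q * (2 * m)
    → IsPowerResidue m p (+ 2)
    → (a : ℤ) → ¬ ((+ p) ℤD.∣ a)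
    → (χ₁ χ₂ : Poly)
    → IsPRS (4 * p * m) p (2 * m) q -[1+ 1 ] χ₁
    → IsPRS (4 * p * m) p (2 * m) q (+ 2) χ₂
    → (prodP (map (λ k → X^ (p * m) ⊖ ζpow (4 * p * m) ((+ (4 * m * k)) ℤ.* a)) (R m p))
    ≈⟨ 4 * p * m ⟩ (χ₁ ⊗ (X^ (p * m) ^P q)))
    × (prodP (map (λ k → X^ (p * m) ⊕ ζpow (4 * p * m) ((+ (4 * m * k)) ℤ.* a)) (R m p))
    ≈⟨ 4 * p * m ⟩ (χ₂ ⊗ (X^ (p * m) ^P q)))
theorem1p2 m p 1≤m p-prime q p∸1≡ 2-residue a p∤a χ₁ χ₂ (root₁ , c₁ , near₁) (root₂ , c₂ , near₂) =
  to (𝔸.trans (∏ᴬ.∏-cong (R m p) (λ {k} _ → 𝔸.trans (𝔸.+-congˡ {i} (𝔸.-‿cong (ζpow≈ k))) (lift (⊕-congˡ i (minus (ω ^ᴳ k))))))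
       (product-formula (ℤ.- + 1) refl {χ₁} {c₁} (from root₁) (from near₁))) ,
  to (𝔸.trans (∏ᴬ.∏-cong (R m p) (λ {k} _ → 𝔸.trans (𝔸.+-congˡ {i} (ζpow≈ k)) (lift (⊕-congˡ i (≋-sym (⊗-identityˡ (ω ^ᴳ k)))))))
       (product-formula (+ 1) refl {χ₂} {c₂} (from root₂) (from near₂)))
  where
  open Roots-in-ℤ[ζ] {m} {p} 1≤m p-prime
  open Monic-quotient Φ-monic-N
  module 𝔸 = ℤ[x]/G
  module ∏ᴬ = Products 𝔸.*-commutativeMonoid
  i = X^ (p * m)
  a′ = proj₁ (ζpow-power a p∤a)
  ζpow≈ = proj₂ (proj₂ (ζpow-power a p∤a))
  open Product-formula {m} {p} {q} 1≤m p-prime p∸1≡ 2-residue Φ-monic-N {i} {X^ (4 * m)} i²≈-1 Σζ≈0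
    {a′} (proj₁ (proj₂ (ζpow-power a p∤a)))

  from : ∀ {f g} → f ≈⟨ N ⟩ g → f ≈ᴳ g
  from {f} {g} e = let h , e′ = ≈⟨⟩⇒multiple {N} Φ-monic-N {f} {g} e in h by e′

  to : ∀ {f g} → f ≈ᴳ g → f ≈⟨ N ⟩ g
  to {f} {g} e = multiple⇒≈⟨⟩ {N} Φ-monic-N {f} {g} (_≈ᴳ_.multiplier e , _≈ᴳ_.equality e)

  minus : ∀ f → negP f ≋ const (ℤ.- + 1) ⊗ f
  minus f = solve 1 (λ x → :- x := con (ℤ.- + 1) :* x) ≋-refl f
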